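{- Let $d\ge 1$ and $n\ge 1$ be integers, and let $Q(d,n)$ denote the maximum integer $q$ such that in every antipodal $n$-fold cover of $S^d$ with open sets there exists a point of $S^d$ that is covered by at least $q$ sets of the cover. Then \[\left\lceil \tfrac{d}{2}\right\rceil + n \le Q(d,n) \le d+n.\]
   Context: $S^d$ denotes the $d$-dimensional unit sphere in $\mathbb{R}^{d+1}$ centered at the origin. A cover of $S^d$ is a (finite) family of subsets of $S^d$; it is an $n$-fold cover if every point of $S^d$ belongs to at least $n$ of the sets. A cover is antipodal if none of its sets contains a pair of antipodal points $x,-x$. A point is covered $k$ times if it belongs to $k$ sets of the cover. -}

module Defs where

open import Level using (0ℓ; suc)
open import Algebra.Bundles using (CommutativeRing)
import Algebra.Definitions.RawMonoid as RawMonoidSum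
open import Data.Fin.Base using (Fin)
open import Data.Fin.Subset using (Subset; ∣_∣) renaming (_∈_ to _∈ₛ_)
open import Data.Nat.Base as ℕ using (ℕ)
open import Data.Product.Base using (Σ; ∃; _×_; proj₁)
open import Data.Vec.Functional using (Vector)
open import Relation.Binary.Core using (Rel)
open import Relation.Binary.Structures using (IsTotalOrder)
import Relation.Binary.Construct.NonStrictToStrict as ToStrict
open import Relation.Nullary.Negation.Core using (¬_)
open import Relation.Unary using (Pred; _∈_; Satisfiable)

-- The real numbers, characterised (classically, up to unique isomorphism) as
-- a Dedekind-complete ordered field.  Equality is the setoid equality _≈_.
record Reals : Set (suc 0ℓ) where
  infix 4 _≤_
  field
    commutativeRing : CommutativeRing 0ℓ 0ℓ

  open CommutativeRing commutativeRing public

  field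
    _≤_          : Rel Carrier 0ℓ
    isTotalOrder : IsTotalOrder _≈_ _≤_
    +-monoˡ-≤    : ∀ {x y} z → x ≤ y → x + z ≤ y + z
    *-nonNeg     : ∀ {x y} → 0# ≤ x → 0# ≤ y → 0# ≤ x * y
    0≉1          : ¬ (0# ≈ 1#)
    inverse      : ∀ x → ¬ (x ≈ 0#) → ∃ λ y → x * y ≈ 1#

  IsUpperBound : Pred Carrier 0ℓ → Carrier → Set
  IsUpperBound P b = ∀ {x} → x ∈ P → x ≤ b

  field
    supremum : (P : Pred Carrier 0ℓ) → Satisfiable P → ∃ (IsUpperBound P) →
               ∃ λ s → IsUpperBound P s × (∀ {b} → IsUpperBound P b → s ≤ b)

  open ToStrict _≈_ _≤_ public using (_<_)
  open RawMonoidSum +-rawMonoid public using (sum)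

module UnitSphere (ℝ : Reals) (d : ℕ) where
  open Reals ℝ

  ‖_‖² : ∀ {k} → Vector Carrier k → Carrier
  ‖ v ‖² = sum λ i → v i * v i

  Sphere : Set
  Sphere = Σ (Vector Carrier (ℕ.suc d)) λ v → ‖ v ‖² ≈ 1#

  coord : Sphere → Vector Carrier (ℕ.suc d)
  coord = proj₁

  dist² : Sphere → Sphere → Carrier
  dist² x y = ‖ (λ i → coord x i - coord y i) ‖²

  -- y = -x
  Antipodes : Rel Sphere 0ℓ
  Antipodes x y = ∀ i → coord y i ≈ - coord x i

  -- Openness in the subspace topology; dist² x y < ε² is ‖x - y‖ < ε without
  -- the square root.  An open set automatically respects coordinatewise _≈_,
  -- since points with ≈-equal coordinates are at distance zero.
  IsOpen : Pred Sphere 0ℓ → Set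
  IsOpen U = ∀ x → x ∈ U →
             ∃ λ ε → 0# < ε × (∀ y → dist² x y < ε * ε → y ∈ U)

  AntipodeFree : Pred Sphere 0ℓ → Set
  AntipodeFree U = ∀ x y → Antipodes x y → ¬ (x ∈ U × y ∈ U)

  Family : ℕ → Set₁
  Family m = Fin m → Pred Sphere 0ℓ

  CoveredAtLeast : ∀ {m} → ℕ → Family m → Sphere → Set
  CoveredAtLeast {m} k U x =
    ∃ λ (I : Subset m) → k ℕ.≤ ∣ I ∣ × (∀ i → i ∈ₛ I → x ∈ U i)

  IsFoldCover : ∀ {m} → ℕ → Family m → Set
  IsFoldCover n U = ∀ x → CoveredAtLeast n U x

  IsAntipodalFoldCover : ∀ {m} → ℕ → Family m → Set
  IsAntipodalFoldCover n U = IsFoldCover n U × (∀ i → AntipodeFree (U i))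

-- Q(d,n) is the maximum of this set of q.
Guaranteed : Reals → (d n : ℕ) → Pred ℕ (suc 0ℓ)
Guaranteed ℝ d n q =
  ∀ m (U : Family m) → IsAntipodalFoldCover n U → (∀ i → IsOpen (U i)) →
  ∃ λ x → CoveredAtLeast q U x
  where open UnitSphere ℝ d

IsMaximum : ∀ {ℓ} → Pred ℕ ℓ → ℕ → Set ℓ
IsMaximum P q = q ∈ P × (∀ q′ → q′ ∈ P → q′ ℕ.≤ q)

{-# OPTIONS --safe #-}

-- Upper bound (Gale): for points p_i on the moment curve with alternating
-- signs, the d + 2n open hemispheres centred at the p_i cover every x at least
-- n times, since a polynomial of degree d has at most d sign changes; and n of
-- them cover -x, hence miss x.
--
-- Lower bound: keeping of U_i only the points that also lie in some U_j with
-- j < i lowers the multiplicity by one, which reduces to n = 1.  If then no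
-- point lies in more than k = ⌈d/2⌉ sets, triangulate the sphere antipodally and
-- so finely that P(σ) = {i : σ ⊆ U_i} is nonempty for every simplex σ, and let
-- the sign of σ say whether the least element of P(σ) ∪ P(-σ) lies in P(σ).
-- Passing to a face of σ enlarges P(σ) and P(-σ), and strictly if the sign
-- changes; since |P(σ)| + |P(-σ)| lies between 2 and 2k ≤ d + 1, no flag of d + 1
-- simplices has alternating signs, contrary to Ky Fan's lemma.
module Submission where

open import Level using (0ℓ; Lift; lift)
open import Algebra.Bundles using (CommutativeRing)
open import Algebra.Bundles.Raw using (RawRing)
import Algebra.Construct.NaturalChoice.Max as NaturalChoiceMax
import Algebra.Construct.NaturalChoice.Min as NaturalChoiceMin
import Algebra.Properties.CommutativeMonoid.Sum as CommutativeMonoidSum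
import Algebra.Properties.CommutativeSemigroup as CommutativeSemigroupProperties
import Algebra.Properties.Monoid.Mult.TCOptimised as MonoidMult
import Algebra.Properties.Ring as RingProperties
import Algebra.Properties.Semiring.Mult as SemiringMult
import Algebra.Properties.Semiring.Sum as SemiringSum
import Algebra.Solver.Ring as RingSolver
open import Algebra.Solver.Ring.AlmostCommutativeRing
  using (fromCommutativeRing; _-Raw-AlmostCommutative⟶_)
open import Axiom.ExcludedMiddle using (ExcludedMiddle)
open import Data.Bool.Base using (Bool; true; false; not; _xor_; _∧_; if_then_else_)
open import Data.Bool.Properties
  using (not-involutive; xor-comm; xor-identityʳ; xor-same; ¬-not)
open import Data.Empty using (⊥)
open import Data.Fin.Base as Fin using (Fin; zero; suc; toℕ)
import Data.Fin.Properties as Fin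
open import Data.Fin.Subset using (Subset; ∣_∣; inside; outside; ∁)
  renaming (_∈_ to _∈ₛ_; _∉_ to _∉ₛ_; _⊆_ to _⊆ₛ_)
open import Data.Fin.Subset.Properties
  using (drop-∷-⊆; p⊆q⇒∣p∣≤∣q∣; x∉p⇒x∈∁p; ∣∁p∣≡n∸∣p∣)
open import Data.Maybe.Base using (Maybe; just; nothing)
open import Data.Nat.Base as ℕ using (ℕ; zero; suc; ⌈_/2⌉)
import Data.Nat.Properties as ℕ
open import Data.Product.Base using (∃; _×_; _,_; proj₁; proj₂)
open import Data.Sum.Base using (_⊎_; inj₁; inj₂; [_,_]′)
open import Data.Vec.Base as Vec using (Vec; []; _∷_; here; there; lookup; map; tabulate)
open import Data.Vec.Functional as Vector using (Vector; head; tail)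
open import Data.Vec.Membership.Propositional using (_∈_)
import Data.Vec.Properties as Vec
open import Data.Vec.Relation.Binary.Pointwise.Inductive using (Pointwise; []; _∷_)
import Data.Vec.Relation.Unary.Any as Any
import Data.Vec.Relation.Unary.Any.Properties as Any
open import Defs
open import Function.Base using (_∘_)
open import Function.Bundles using (mk⇔)
open import Relation.Binary.Bundles using (TotalOrder)
open import Relation.Binary.PropositionalEquality as ≡ using (_≡_; _≗_)
open import Relation.Binary.Structures using (IsTotalOrder)
open import Relation.Nullary using (¬_; Dec; yes; no; does; contradiction)
open import Relation.Nullary.Decidable using (decidable-stable; dec-true; does-⇔; map′)
open import Relation.Unary using (Pred)

-- No triangulation is ever built. Cochains live on all tuples of vertices, subdivision acts on them
-- by coning, and Fan pairs pull back along it. The parity is therefore computed only on the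
-- cross-polytope, an iterated join of two-point sets with an explicit fundamental cycle. Which
-- simplices occur matters only when a cochain is shown to vanish, and `Flag` records that. The
-- cross-polytope suits the counting, but the metric side wants boxes. Its barycentric subdivision
-- is also that of the boundary of the dual cube, whose facets are products of intervals: they are
-- compact by induction on the coordinates and contain the bounding boxes of their simplices. Coning
-- from centres of bounding boxes halves the coordinatewise diameter in each round, whatever the
-- dimension. The boundary of the cube lies outside the open unit ball, where radial projection does
-- not expand distances. For the upper bound the nodes are 0, 1, 2, ... and the moment curve is
-- written in the basis binomial(i, j): taking differences drops a coordinate, and a discrete Rolle
-- argument replaces the counting of roots.

private
  variable
    V W   : Set
    k m n : ℕ

-- Cochains modulo 2

-- A vector of length n stands for an ordered simplex with n vertices, repetitions allowed. Length 0
-- is the empty simplex, so the complex is augmented.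
Cochain : Set → ℕ → Set
Cochain V n = Vec V n → Bool

infixl 6 _⊕_
_⊕_ : Cochain V n → Cochain V n → Cochain V n
(φ ⊕ ψ) τ = φ τ xor ψ τ

δ : Cochain V n → Cochain V (suc n)
δ {n = zero}  φ (v ∷ [])  = φ []
δ {n = suc n} φ (v ∷ τ) = φ τ xor δ (φ ∘ (v ∷_)) τ

data Facet {V : Set} : Vec V n → Vec V (suc n) → Set where
  here  : ∀ {v} {τ : Vec V n} → Facet τ (v ∷ τ)
  there : ∀ {v} {σ : Vec V n} {τ} → Facet σ τ → Facet (v ∷ σ) (v ∷ τ)

xor-interchange : ∀ a b c d → (a xor b) xor (c xor d) ≡ (a xor c) xor (b xor d)
xor-interchange true  true  true  d = ≡.refl
xor-interchange true  true  false d = ≡.sym (not-involutive d)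
xor-interchange true  false true  d = not-involutive d
xor-interchange true  false false d = ≡.refl
xor-interchange false true  true  d = ≡.refl
xor-interchange false true  false d = ≡.refl
xor-interchange false false c     d = ≡.refl

xor-cancelˡ : ∀ a b → a xor (a xor b) ≡ b
xor-cancelˡ true  b = not-involutive b
xor-cancelˡ false b = ≡.refl

xor-cancelʳ : ∀ a b → a xor (b xor a) ≡ b xor false
xor-cancelʳ a b = ≡.trans (≡.cong (a xor_) (xor-comm b a))
  (≡.trans (xor-cancelˡ a b) (≡.sym (xor-identityʳ b)))

δ-cong : ∀ {φ ψ : Cochain V n} → φ ≗ ψ → δ φ ≗ δ ψ
δ-cong {n = zero}  φ≗ψ (v ∷ []) = φ≗ψ []
δ-cong {n = suc n} φ≗ψ (v ∷ τ)  = ≡.cong₂ _xor_ (φ≗ψ τ) (δ-cong (φ≗ψ ∘ (v ∷_)) τ)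

δ-⊕ : ∀ (φ ψ : Cochain V n) → δ (φ ⊕ ψ) ≗ δ φ ⊕ δ ψ
δ-⊕ {n = zero}  φ ψ (v ∷ []) = ≡.refl
δ-⊕ {n = suc n} φ ψ (v ∷ τ)  =
  ≡.trans (≡.cong ((φ τ xor ψ τ) xor_) (δ-⊕ (φ ∘ (v ∷_)) (ψ ∘ (v ∷_)) τ))
        (xor-interchange (φ τ) (ψ τ) _ _)

-- Splitting off the head makes `δ φ τ` appear twice and cancel; what remains is the same identity
-- for the link of the head.
δ∘δ : ∀ (φ : Cochain V n) τ → δ (δ φ) τ ≡ false
δ∘δ {n = zero}  φ (v ∷ w ∷ []) = xor-same (φ [])
δ∘δ {n = suc n} φ (v ∷ τ) = begin
  δ φ τ xor δ (φ ⊕ δ (φ ∘ (v ∷_))) τ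
    ≡⟨ ≡.cong (δ φ τ xor_) (δ-⊕ φ (δ (φ ∘ (v ∷_))) τ) ⟩
  δ φ τ xor (δ φ τ xor δ (δ (φ ∘ (v ∷_))) τ)
    ≡⟨ xor-cancelˡ (δ φ τ) _ ⟩
  δ (δ (φ ∘ (v ∷_))) τ
    ≡⟨ δ∘δ (φ ∘ (v ∷_)) τ ⟩
  false ∎
  where open ≡.≡-Reasoning

δ-vanishes : ∀ (φ : Cochain V n) τ → (∀ σ → Facet σ τ → φ σ ≡ false) → δ φ τ ≡ false
δ-vanishes {n = zero}  φ (v ∷ []) φ≡0 = φ≡0 [] here
δ-vanishes {n = suc n} φ (v ∷ τ)  φ≡0 =
  ≡.cong₂ _xor_ (φ≡0 τ here) (δ-vanishes (φ ∘ (v ∷_)) τ (λ σ f → φ≡0 (v ∷ σ) (there f)))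

δ-related : ∀ {R : V → W → Set} {φ : Cochain V n} {ψ : Cochain W n} →
            (∀ {σ σ′} → Pointwise R σ σ′ → φ σ ≡ ψ σ′) →
            ∀ {τ τ′} → Pointwise R τ τ′ → δ φ τ ≡ δ ψ τ′
δ-related {n = zero}  eq (r ∷ []) = eq []
δ-related {n = suc n} eq (r ∷ rs) = ≡.cong₂ _xor_ (eq rs) (δ-related (eq ∘ (r ∷_)) rs)

-- The coning recursion sd σ = c(σ) * sd(∂σ), read on cochains.
module Subdivision {V W : Set} (apex : ∀ {n} → Vec V (suc n) → W) where

  sd : Cochain W n → Cochain V n
  sd {n = zero}  φ []  = φ []
  sd {n = suc n} φ τ = δ (sd (φ ∘ (apex τ ∷_))) τ

  sd-cong : ∀ {φ ψ : Cochain W n} → φ ≗ ψ → sd φ ≗ sd ψ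
  sd-cong {n = zero}  φ≗ψ [] = φ≗ψ []
  sd-cong {n = suc n} φ≗ψ τ  = δ-cong (sd-cong (φ≗ψ ∘ (apex τ ∷_))) τ

  sd-⊕ : ∀ (φ ψ : Cochain W n) → sd (φ ⊕ ψ) ≗ sd φ ⊕ sd ψ
  sd-⊕ {n = zero}  φ ψ [] = ≡.refl
  sd-⊕ {n = suc n} φ ψ τ =
    ≡.trans (δ-cong (sd-⊕ (φ ∘ (apex τ ∷_)) (ψ ∘ (apex τ ∷_))) τ) (δ-⊕ _ _ τ)

  -- `δ` either deletes the apex, which gives `φ` itself, or keeps it; by induction the terms that
  -- keep it form a double coboundary and vanish.
  sd∘δ : ∀ (φ : Cochain W n) → sd (δ φ) ≗ δ (sd φ)
  sd∘δ {n = zero}  φ (v ∷ []) = ≡.refl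
  sd∘δ {n = suc n} φ τ = begin
    δ (sd (φ ⊕ δ (φ ∘ (apex τ ∷_)))) τ
      ≡⟨ δ-cong (sd-⊕ φ (δ (φ ∘ (apex τ ∷_)))) τ ⟩
    δ (sd φ ⊕ sd (δ (φ ∘ (apex τ ∷_)))) τ
      ≡⟨ δ-⊕ (sd φ) (sd (δ (φ ∘ (apex τ ∷_)))) τ ⟩
    δ (sd φ) τ xor δ (sd (δ (φ ∘ (apex τ ∷_)))) τ
      ≡⟨ ≡.cong (δ (sd φ) τ xor_) (≡.trans (δ-cong (sd∘δ (φ ∘ (apex τ ∷_))) τ) (δ∘δ _ τ)) ⟩
    δ (sd φ) τ xor false
      ≡⟨ xor-identityʳ _ ⟩
    δ (sd φ) τ ∎
    where open ≡.≡-Reasoning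

  -- The simplices occurring in the subdivision of τ.
  data Flag : ∀ {n} → Vec V n → Vec W n → Set where
    []  : Flag [] []
    _∷_ : ∀ {n σ ρ} {τ : Vec V (suc n)} → Facet σ τ → Flag σ ρ → Flag τ (apex τ ∷ ρ)

  sd-vanishes : ∀ (φ : Cochain W n) τ → (∀ ρ → Flag τ ρ → φ ρ ≡ false) → sd φ τ ≡ false
  sd-vanishes {n = zero}  φ [] φ≡0 = φ≡0 [] []
  sd-vanishes {n = suc n} φ τ φ≡0 =
    δ-vanishes _ τ (λ σ f → sd-vanishes _ σ (λ ρ fl → φ≡0 (apex τ ∷ ρ) (f ∷ fl)))

-- A pair of cochain families exchanged by the antipodality relation R, with
-- δβ⁺ = β⁺ + β⁻: Ky Fan's counting cochains are an instance.
record FanPair (V : Set) (R : V → V → Set) : Set where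
  field
    β⁺ β⁻    : ∀ n → Cochain V n
    β⁺-empty : β⁺ 0 [] ≡ true
    δβ⁺      : ∀ n → δ (β⁺ n) ≗ β⁺ (suc n) ⊕ β⁻ (suc n)
    swap     : ∀ n {τ τ′} → Pointwise R τ τ′ → β⁺ n τ ≡ β⁻ n τ′

open FanPair

subdivide : ∀ {R : V → V → Set} {R′ : W → W → Set}
            (apex : ∀ {n} → Vec V (suc n) → W) →
            (∀ {n} {τ τ′ : Vec V (suc n)} → Pointwise R τ τ′ → R′ (apex τ) (apex τ′)) →
            FanPair W R′ → FanPair V R
subdivide {R = R} {R′} apex apex-R F = record
  { β⁺       = λ n → sd (β⁺ F n)
  ; β⁻       = λ n → sd (β⁻ F n)
  ; β⁺-empty = β⁺-empty F
  ; δβ⁺      = λ n τ → ≡.trans (≡.sym (sd∘δ (β⁺ F n) τ))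
                         (≡.trans (sd-cong (δβ⁺ F n) τ) (sd-⊕ (β⁺ F (suc n)) (β⁻ F (suc n)) τ))
  ; swap     = λ n → sd-related (swap F n)
  }
  where
  open Subdivision apex
  sd-related : ∀ {n} {φ ψ : Cochain _ n} →
               (∀ {σ σ′} → Pointwise R′ σ σ′ → φ σ ≡ ψ σ′) →
               ∀ {τ τ′} → Pointwise R τ τ′ → sd φ τ ≡ sd ψ τ′
  sd-related {zero}  eq []       = eq []
  sd-related {suc n} eq (r ∷ rs) =
    δ-related (sd-related (λ rs′ → eq (apex-R (r ∷ rs) ∷ rs′))) (r ∷ rs)

alternating : Bool → Vec Bool n → Bool
alternating s []      = true
alternating s (t ∷ τ) = not (s xor t) ∧ alternating (not s) τ

δ-false : ∀ (τ : Vec V (suc n)) → δ {n = n} (λ _ → false) τ ≡ false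
δ-false τ = δ-vanishes (λ _ → false) τ (λ _ _ → ≡.refl)

-- Deleting an entry can leave an alternating word only if the word alternates or has exactly one
-- pair of equal neighbours. For such a pair either member may go and the two results agree, so they
-- cancel. In an alternating word exactly one end can be deleted so that the rest starts with `s`.
δ-alternating : ∀ s (τ : Vec Bool (suc n)) →
                δ (alternating s) τ ≡ alternating s τ xor alternating (not s) τ
δ-alternating {zero}  true  (true  ∷ []) = ≡.refl
δ-alternating {zero}  true  (false ∷ []) = ≡.refl
δ-alternating {zero}  false (true  ∷ []) = ≡.refl
δ-alternating {zero}  false (false ∷ []) = ≡.refl
δ-alternating {suc n} true  (true  ∷ τ)
  rewrite δ-alternating false τ = xor-cancelʳ (alternating true τ) (alternating false τ)
δ-alternating {suc n} true  (false ∷ τ)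
  rewrite δ-false {n = n} τ = xor-identityʳ _
δ-alternating {suc n} false (true  ∷ τ)
  rewrite δ-false {n = n} τ = xor-identityʳ _
δ-alternating {suc n} false (false ∷ τ)
  rewrite δ-alternating true τ = xor-cancelʳ (alternating false τ) (alternating true τ)

δ-map : ∀ (f : V → W) (φ : Cochain W n) τ → δ (φ ∘ map f) τ ≡ δ φ (map f τ)
δ-map {n = zero}  f φ (v ∷ []) = ≡.refl
δ-map {n = suc n} f φ (v ∷ τ)  = ≡.cong (φ (map f τ) xor_) (δ-map f (φ ∘ (f v ∷_)) τ)

signPair : ∀ {R : V → V → Set} (sign : V → Bool) →
           (∀ {v w} → R v w → sign w ≡ not (sign v)) → FanPair V R
signPair {R = R} sign odd = record
  { β⁺       = λ n → alternating true ∘ map sign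
  ; β⁻       = λ n → alternating false ∘ map sign
  ; β⁺-empty = ≡.refl
  ; δβ⁺      = λ n τ → ≡.trans (δ-map sign (alternating true) τ)
      (δ-alternating true (map sign τ))
  ; swap     = λ n → related true
  }
  where
  related : ∀ {n} s {τ τ′ : Vec _ n} → Pointwise R τ τ′ →
            alternating s (map sign τ) ≡ alternating (not s) (map sign τ′)
  related s []                     = ≡.refl
  related s (_∷_ {x = v} {y = w} r rs) =
    ≡.cong₂ _∧_ (≡.cong not (≡.trans (flip s (sign v)) (≡.cong (not s xor_) (≡.sym (odd r)))))
        (related (not s) rs)
    where
    flip : ∀ a b → a xor b ≡ not a xor not b
    flip true  true  = ≡.refl
    flip true  false = ≡.refl
    flip false true  = ≡.refl
    flip false false = ≡.refl

-- The boundary of the cross-polytope with vertex pairs {w, opp w}.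
module CrossPolytope {W : Set} (opp : W → W) (opp-involutive : ∀ w → opp (opp w) ≡ w) where

  -- The fundamental cycle of the iterated join: each place independently receives a vertex or its
  -- opposite.
  evaluate : Vec W n → Cochain W n → Bool
  evaluate []       φ = φ []
  evaluate (w ∷ ws) φ = evaluate ws (φ ∘ (w ∷_)) xor evaluate ws (φ ∘ (opp w ∷_))

  evaluate-cong : ∀ (ws : Vec W n) {φ ψ} → φ ≗ ψ → evaluate ws φ ≡ evaluate ws ψ
  evaluate-cong []       eq = eq []
  evaluate-cong (w ∷ ws) eq =
    ≡.cong₂ _xor_ (evaluate-cong ws (eq ∘ (w ∷_))) (evaluate-cong ws (eq ∘ (opp w ∷_)))

  evaluate-⊕ : ∀ (ws : Vec W n) φ ψ → evaluate ws (φ ⊕ ψ) ≡ evaluate ws φ xor evaluate ws ψ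
  evaluate-⊕ []       φ ψ = ≡.refl
  evaluate-⊕ (w ∷ ws) φ ψ = ≡.trans (≡.cong₂ _xor_ (evaluate-⊕ ws _ _) (evaluate-⊕ ws _ _))
    (xor-interchange (evaluate ws (φ ∘ (w ∷_))) _ _ _)

  -- The sphere consists of two cones over its equator, and their boundaries cancel. That the
  -- boundary of a cone is just the equator uses in turn that the equator is a cycle, hence the
  -- mutual recursion.
  evaluate-δ : ∀ (w : W) (ws : Vec W n) φ → evaluate (w ∷ ws) (δ φ) ≡ false
  evaluate-cone-δ : ∀ (w : W) (ws : Vec W n) φ → evaluate ws (δ φ ∘ (w ∷_)) ≡ evaluate ws φ

  evaluate-cone-δ w []       φ = ≡.refl
  evaluate-cone-δ w (x ∷ ws) φ = ≡.trans (evaluate-⊕ (x ∷ ws) φ (δ (φ ∘ (w ∷_))))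
    (≡.trans (≡.cong (evaluate (x ∷ ws) φ xor_) (evaluate-δ x ws _)) (xor-identityʳ _))

  evaluate-δ w ws φ = ≡.trans
    (≡.cong₂ _xor_ (evaluate-cone-δ w ws φ) (evaluate-cone-δ (opp w) ws φ))
    (xor-same (evaluate ws φ))

  Opposite : W → W → Set
  Opposite w w′ = w′ ≡ opp w

  -- The antipodal map permutes the facets of the cross-polytope.
  evaluate-related : ∀ (ws : Vec W n) {φ ψ} →
                     (∀ {σ σ′} → Pointwise Opposite σ σ′ → φ σ ≡ ψ σ′) →
                     evaluate ws φ ≡ evaluate ws ψ
  evaluate-related []       eq = eq []
  evaluate-related (w ∷ ws) eq = ≡.trans
    (≡.cong₂ _xor_ (evaluate-related ws (λ r → eq (≡.refl ∷ r)))
                 (evaluate-related ws (λ r → eq (≡.sym (opp-involutive w) ∷ r))))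
    (xor-comm (evaluate ws _) _)

  -- Ky Fan: the antipodal halves of the sphere contribute β⁺ and β⁻ on one
  -- hemisphere, and β⁺ + β⁻ = δβ⁺ evaluates there to β⁺ on the equator.
  fan : ∀ (F : FanPair W Opposite) (ws : Vec W n) → evaluate ws (β⁺ F n) ≡ true
  fan F []       = β⁺-empty F
  fan {suc n} F (w ∷ ws) = begin
    evaluate ws (β⁺ F _ ∘ (w ∷_)) xor evaluate ws (β⁺ F _ ∘ (opp w ∷_))
      ≡⟨ ≡.cong (evaluate ws (β⁺ F _ ∘ (w ∷_)) xor_)
           (evaluate-related ws (λ r → swap F _ (≡.sym (opp-involutive w) ∷ r))) ⟩
    evaluate ws (β⁺ F _ ∘ (w ∷_)) xor evaluate ws (β⁻ F _ ∘ (w ∷_))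
      ≡⟨ evaluate-⊕ ws _ _ ⟨
    evaluate ws ((β⁺ F _ ⊕ β⁻ F _) ∘ (w ∷_))
      ≡⟨ evaluate-cong ws (λ τ → ≡.sym (δβ⁺ F n (w ∷ τ))) ⟩
    evaluate ws (δ (β⁺ F n) ∘ (w ∷_))
      ≡⟨ evaluate-cone-δ w ws (β⁺ F n) ⟩
    evaluate ws (β⁺ F n)
      ≡⟨ fan F ws ⟩
    true ∎
    where open ≡.≡-Reasoning

  data Transversal : Vec W n → Vec W n → Set where
    []   : Transversal [] []
    keep : ∀ {w} {ws τ : Vec W n} → Transversal ws τ → Transversal (w ∷ ws) (w ∷ τ)
    flip : ∀ {w} {ws τ : Vec W n} → Transversal ws τ → Transversal (w ∷ ws) (opp w ∷ τ)

  evaluate-vanishes : ∀ (ws : Vec W n) φ → (∀ τ → Transversal ws τ → φ τ ≡ false) →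
                      evaluate ws φ ≡ false
  evaluate-vanishes []       φ φ≡0 = φ≡0 [] []
  evaluate-vanishes (w ∷ ws) φ φ≡0 = ≡.cong₂ _xor_
    (evaluate-vanishes ws _ (λ τ t → φ≡0 _ (keep t)))
    (evaluate-vanishes ws _ (λ τ t → φ≡0 _ (flip t)))

-- Ordered fields

-- A ring solver whose coefficients are formal differences of naturals, so
-- that integer coefficients are compared and x - x is simplified.
module IntegerSolver (R : CommutativeRing 0ℓ 0ℓ) where
  open CommutativeRing R
  open RingProperties ring using (-‿distribˡ-*; -‿distribʳ-*; -‿+-comm; -‿involutive; -0#≈0#)
  open SemiringMult semiring using ()
    renaming (_×_ to _·_; ×-homo-+ to ·-homo-+; ×1-homo-* to ·1-homo-*; ×-homo-1 to ·-homo-1)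
  open MonoidMult +-monoid using () renaming (_×_ to _·′_; ×ᵤ≈× to ·≈·′)
  open CommutativeSemigroupProperties +-commutativeSemigroup using (interchange)
  open import Relation.Binary.Reasoning.Setoid setoid

  private
    normalise : ℕ × ℕ → ℕ × ℕ
    normalise (suc a , suc b) = normalise (a , b)
    normalise p               = p

    coefficients : RawRing 0ℓ 0ℓ
    coefficients = record
      { Carrier = ℕ × ℕ
      ; _≈_ = _≡_
      ; _+_ = λ (a , b) (c , d) → normalise (a ℕ.+ c , b ℕ.+ d)
      ; _*_ = λ (a , b) (c , d) → normalise (a ℕ.* c ℕ.+ b ℕ.* d , a ℕ.* d ℕ.+ b ℕ.* c)
      ; -_  = λ (a , b) → b , a
      ; 0#  = 0 , 0
      ; 1#  = 1 , 0
      }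

    module C = RawRing coefficients

    ⟪_⟫ : ℕ × ℕ → Carrier
    ⟪ a , b ⟫ = a · 1# - b · 1#

    -- Unlike ⟪_⟫, it maps (0 , 0) and (1 , 0) definitionally to 0# and 1#.
    ⟦_⟧ : ℕ × ℕ → Carrier
    ⟦ a , zero ⟧  = a ·′ 1#
    ⟦ a , suc b ⟧ = ⟪ a , suc b ⟫

    spec : ∀ p → ⟦ p ⟧ ≈ ⟪ p ⟫
    spec (a , zero)  = trans (sym (·≈·′ a 1#)) (sym (trans (+-congˡ -0#≈0#) (+-identityʳ _)))
    spec (a , suc b) = refl

    -‿+ : ∀ x y → - (x + y) ≈ - x - y
    -‿+ x y = sym (-‿+-comm x y)

    normalise-homo : ∀ a b → ⟪ normalise (a , b) ⟫ ≈ ⟪ a , b ⟫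
    normalise-homo zero    b       = refl
    normalise-homo (suc a) zero    = refl
    normalise-homo (suc a) (suc b) = begin
      ⟪ normalise (a , b) ⟫                  ≈⟨ normalise-homo a b ⟩
      a · 1# - b · 1#                        ≈⟨ +-identityˡ _ ⟨
      0# + (a · 1# - b · 1#)                 ≈⟨ +-congʳ (-‿inverseʳ 1#) ⟨
      (1# - 1#) + (a · 1# - b · 1#)          ≈⟨ interchange _ _ _ _ ⟩
      (1# + a · 1#) + (- 1# - b · 1#)        ≈⟨ +-congˡ (-‿+ _ _) ⟨
      (1# + a · 1#) - (1# + b · 1#)          ∎

    +-homo : ∀ p q → ⟪ p C.+ q ⟫ ≈ ⟪ p ⟫ + ⟪ q ⟫
    +-homo (a , b) (c , d) = begin
      ⟪ normalise (a ℕ.+ c , b ℕ.+ d) ⟫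
        ≈⟨ normalise-homo (a ℕ.+ c) (b ℕ.+ d) ⟩
      (a ℕ.+ c) · 1# - (b ℕ.+ d) · 1#
        ≈⟨ +-cong (·-homo-+ 1# a c) (trans (-‿cong (·-homo-+ 1# b d)) (-‿+ _ _)) ⟩
      (a · 1# + c · 1#) + (- (b · 1#) - d · 1#)
        ≈⟨ interchange _ _ _ _ ⟩
      (a · 1# - b · 1#) + (c · 1# - d · 1#) ∎

    difference-* : ∀ a b c d → (a - b) * (c - d) ≈ (a * c + b * d) - (a * d + b * c)
    difference-* a b c d = begin
      (a - b) * (c - d)
        ≈⟨ distribʳ _ _ _ ⟩
      a * (c - d) + - b * (c - d)
        ≈⟨ +-cong (distribˡ _ _ _) (distribˡ _ _ _) ⟩
      (a * c + a * - d) + (- b * c + - b * - d)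
        ≈⟨ +-congˡ (+-comm _ _) ⟩
      (a * c + a * - d) + (- b * - d + - b * c)
        ≈⟨ interchange _ _ _ _ ⟩
      (a * c + - b * - d) + (a * - d + - b * c)
        ≈⟨ +-cong (+-congˡ minus-minus)
            (+-cong (sym (-‿distribʳ-* a d)) (sym (-‿distribˡ-* b c))) ⟩
      (a * c + b * d) + (- (a * d) - b * c)
        ≈⟨ +-congˡ (-‿+-comm _ _) ⟩
      (a * c + b * d) - (a * d + b * c) ∎
      where
      minus-minus : - b * - d ≈ b * d
      minus-minus = trans (sym (-‿distribˡ-* b (- d)))
        (trans (-‿cong (sym (-‿distribʳ-* b d))) (-‿involutive _))

    products : ∀ a b c d → (a ℕ.* c ℕ.+ b ℕ.* d) · 1# ≈ a · 1# * c · 1# + b · 1# * d · 1#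
    products a b c d = trans (·-homo-+ 1# (a ℕ.* c) (b ℕ.* d))
        (+-cong (·1-homo-* a c) (·1-homo-* b d))

    *-homo : ∀ p q → ⟪ p C.* q ⟫ ≈ ⟪ p ⟫ * ⟪ q ⟫
    *-homo (a , b) (c , d) = trans
      (trans (normalise-homo (a ℕ.* c ℕ.+ b ℕ.* d) (a ℕ.* d ℕ.+ b ℕ.* c))
          (+-cong (products a b c d) (-‿cong (products a b d c))))
      (sym (difference-* (a · 1#) (b · 1#) (c · 1#) (d · 1#)))

    -‿homo : ∀ p → ⟪ C.- p ⟫ ≈ - ⟪ p ⟫
    -‿homo (a , b) = begin
      b · 1# - a · 1#         ≈⟨ +-comm _ _ ⟩
      - (a · 1#) + b · 1#     ≈⟨ +-congˡ (-‿involutive _) ⟨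
      - (a · 1#) - - (b · 1#) ≈⟨ -‿+-comm _ _ ⟩
      - (a · 1# - b · 1#)     ∎

    homomorphism : coefficients -Raw-AlmostCommutative⟶ fromCommutativeRing R
    homomorphism = record
      { ⟦_⟧    = ⟦_⟧
      ; +-homo = λ p q → trans (spec (p C.+ q))
          (trans (+-homo p q) (sym (+-cong (spec p) (spec q))))
      ; *-homo = λ p q → trans (spec (p C.* q))
          (trans (*-homo p q) (sym (*-cong (spec p) (spec q))))
      ; -‿homo = λ p → trans (spec (C.- p)) (trans (-‿homo p) (sym (-‿cong (spec p))))
      ; 0-homo = refl
      ; 1-homo = refl
      }

    _≟_ : ∀ p q → Maybe (⟦ p ⟧ ≈ ⟦ q ⟧)
    (a , b) ≟ (c , d) with a ℕ.+ d ℕ.≟ c ℕ.+ b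
    ... | no  _  = nothing
    ... | yes eq = just (trans (spec (a , b)) (trans (begin
      a · 1# - b · 1#
        ≈⟨ +-congʳ (+-identityʳ _) ⟨
      (a · 1# + 0#) - b · 1#
        ≈⟨ +-congʳ (+-congˡ (-‿inverseʳ (d · 1#))) ⟨
      (a · 1# + (d · 1# - d · 1#)) - b · 1#
        ≈⟨ +-congʳ (+-assoc _ _ _) ⟨
      ((a · 1# + d · 1#) - d · 1#) - b · 1#
        ≈⟨ +-congʳ (+-congʳ a+d≈c+b) ⟩
      ((c · 1# + b · 1#) - d · 1#) - b · 1#
        ≈⟨ +-assoc _ _ _ ⟩
      (c · 1# + b · 1#) + (- (d · 1#) - b · 1#)
        ≈⟨ interchange _ _ _ _ ⟩
      (c · 1# - d · 1#) + (b · 1# - b · 1#)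
        ≈⟨ +-congˡ (-‿inverseʳ _) ⟩
      (c · 1# - d · 1#) + 0#
        ≈⟨ +-identityʳ _ ⟩
      c · 1# - d · 1# ∎) (sym (spec (c , d)))))
      where
      a+d≈c+b : a · 1# + d · 1# ≈ c · 1# + b · 1#
      a+d≈c+b = trans (sym (·-homo-+ 1# a d))
          (trans (reflexive (≡.cong (_· 1#) eq)) (·-homo-+ 1# c b))

  open RingSolver coefficients (fromCommutativeRing R) homomorphism _≟_ public
    using (Polynomial; solve; _:=_; _:+_; _:*_; _:-_; :-_)

  :0 :1 : ∀ {n} → Polynomial n
  :0 = RingSolver.con (0 , 0)
  :1 = RingSolver.con (1 , 0)

module OrderedField (ℝ : Reals) where
  open Reals ℝ
  open IntegerSolver commutativeRing public
  open IsTotalOrder isTotalOrder public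
    using (total; ≤-respˡ-≈; ≤-respʳ-≈)
    renaming (refl to ≤-refl; reflexive to ≤-reflexive; trans to ≤-trans; antisym to ≤-antisym)

  abstract
    -- Inequalities are certified by writing the difference of the two sides as
    -- a sum of products of nonnegative quantities.
    ≤-by : ∀ {x y e} → 0# ≤ e → y - x ≈ e → x ≤ y
    ≤-by {x} {y} {e} 0≤e eq = ≤-respˡ-≈ (+-identityˡ x)
      (≤-respʳ-≈ (trans (+-congʳ (sym eq)) (solve 2 (λ x y → y :- x :+ x := y) refl x y))
        (+-monoˡ-≤ x 0≤e))

    gap : ∀ {x y} → x ≤ y → 0# ≤ y - x
    gap {x} {y} x≤y = ≤-respˡ-≈ (-‿inverseʳ x) (+-monoˡ-≤ (- x) x≤y)

    <⇒≤ : ∀ {x y} → x < y → x ≤ y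
    <⇒≤ = proj₁

    <-irrefl : ∀ {x y} → x < y → ¬ (y ≤ x)
    <-irrefl (x≤y , x≉y) y≤x = x≉y (≤-antisym x≤y y≤x)

    ≰⇒> : ∀ {x y} → ¬ (x ≤ y) → y < x
    ≰⇒> {x} {y} x≰y with total x y
    ... | inj₁ x≤y = contradiction x≤y x≰y
    ... | inj₂ y≤x = y≤x , λ y≈x → x≰y (≤-reflexive (sym y≈x))

    <-≤-trans : ∀ {x y z} → x < y → y ≤ z → x < z
    <-≤-trans x<y y≤z = ≤-trans (<⇒≤ x<y) y≤z ,
      λ x≈z → <-irrefl x<y (≤-respʳ-≈ (sym x≈z) y≤z)

    ≤-<-trans : ∀ {x y z} → x ≤ y → y < z → x < z
    ≤-<-trans x≤y y<z = ≤-trans x≤y (<⇒≤ y<z) ,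
      λ x≈z → <-irrefl y<z (≤-respˡ-≈ x≈z x≤y)

    <-respʳ-≈ : ∀ {x y z} → y ≈ z → x < y → x < z
    <-respʳ-≈ y≈z x<y = <-≤-trans x<y (≤-reflexive y≈z)

    <-by : ∀ {x y e} → 0# < e → y - x ≈ e → x < y
    <-by {x} {y} {e} 0<e eq = ≤-by (<⇒≤ 0<e) eq ,
      λ x≈y → proj₂ 0<e (trans (sym (-‿inverseʳ x)) (trans (+-congʳ x≈y) eq))

    gap-< : ∀ {x y} → x < y → 0# < y - x
    gap-< {x} {y} x<y = gap (<⇒≤ x<y) , λ 0≈y-x → proj₂ x<y
      (trans (trans (sym (+-identityˡ x)) (+-congʳ 0≈y-x))
          (solve 2 (λ x y → y :- x :+ x := y) refl x y))

    +-nonNeg : ∀ {x y} → 0# ≤ x → 0# ≤ y → 0# ≤ x + y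
    +-nonNeg {x} {y} 0≤x 0≤y = ≤-trans 0≤x
      (≤-by 0≤y (solve 2 (λ x y → x :+ y :- x := y) refl x y))

    +-posˡ : ∀ {x y} → 0# < x → 0# ≤ y → 0# < x + y
    +-posˡ {x} {y} 0<x 0≤y = <-≤-trans 0<x
      (≤-by 0≤y (solve 2 (λ x y → x :+ y :- x := y) refl x y))

    +-pos : ∀ {x y} → 0# < x → 0# < y → 0# < x + y
    +-pos 0<x 0<y = +-posˡ 0<x (<⇒≤ 0<y)

    *-pos : ∀ {x y} → 0# < x → 0# < y → 0# < x * y
    *-pos {x} {y} 0<x 0<y = *-nonNeg (<⇒≤ 0<x) (<⇒≤ 0<y) , λ 0≈xy →
      let (z , yz≈1) = inverse y (λ y≈0 → proj₂ 0<y (sym y≈0)) in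
      proj₂ 0<x (sym (begin
        x           ≈⟨ *-identityʳ x ⟨
        x * 1#      ≈⟨ *-congˡ yz≈1 ⟨
        x * (y * z) ≈⟨ *-assoc x y z ⟨
        x * y * z   ≈⟨ *-congʳ 0≈xy ⟨
        0# * z      ≈⟨ zeroˡ z ⟩
        0#          ∎))
      where open import Relation.Binary.Reasoning.Setoid setoid

    square-nonNeg : ∀ x → 0# ≤ x * x
    square-nonNeg x with total 0# x
    ... | inj₁ 0≤x = *-nonNeg 0≤x 0≤x
    ... | inj₂ x≤0 = ≤-respʳ-≈ (solve 1 (λ x → (:0 :- x) :* (:0 :- x) := x :* x) refl x)
                               (*-nonNeg (gap x≤0) (gap x≤0))

    0<1 : 0# < 1#
    0<1 = ≤-respʳ-≈ (*-identityʳ 1#) (square-nonNeg 1#) , 0≉1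

    0<2 : 0# < 1# + 1#
    0<2 = +-pos 0<1 0<1

    pos-inverse : ∀ {x} → 0# < x → ∃ λ y → 0# < y × x * y ≈ 1#
    pos-inverse {x} 0<x with inverse x (λ x≈0 → proj₂ 0<x (sym x≈0))
    ... | y , xy≈1 = y , ≰⇒> y≰0 , xy≈1
      where
      y≰0 : ¬ (y ≤ 0#)
      y≰0 y≤0 = <-irrefl 0<1 (≤-by (*-nonNeg (<⇒≤ 0<x) (gap y≤0))
        (trans (+-congˡ (-‿cong (sym xy≈1)))
            (solve 2 (λ x y → :0 :- x :* y := x :* (:0 :- y)) refl x y)))

    ½ : Carrier
    ½ = proj₁ (pos-inverse 0<2)

    0<½ : 0# < ½
    0<½ = proj₁ (proj₂ (pos-inverse 0<2))

    halves : ∀ x → ½ * x + ½ * x ≈ x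
    halves x = trans (solve 2 (λ h x → h :* x :+ h :* x := (:1 :+ :1) :* h :* x) refl ½ x)
                     (trans (*-congʳ (proj₂ (proj₂ (pos-inverse 0<2)))) (*-identityˡ x))

    half-pos : ∀ {x} → 0# < x → 0# < ½ * x
    half-pos = *-pos 0<½

    +-mono-≤ : ∀ {x y z w} → x ≤ y → z ≤ w → x + z ≤ y + w
    +-mono-≤ {x} {y} {z} {w} x≤y z≤w = ≤-by (+-nonNeg (gap x≤y) (gap z≤w))
      (solve 4 (λ x y z w → y :+ w :- (x :+ z) := (y :- x) :+ (w :- z)) refl x y z w)

    neg-mono-≤ : ∀ {x y} → x ≤ y → - y ≤ - x
    neg-mono-≤ {x} {y} x≤y = ≤-by (gap x≤y) (solve 2 (λ x y → :- x :- :- y := y :- x) refl x y)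

    x-ε<x : ∀ {ε} x → 0# < ε → x - ε < x
    x-ε<x {ε} x 0<ε = <-by 0<ε (solve 2 (λ x e → x :- (x :- e) := e) refl x ε)

    x<x+ε : ∀ {ε} x → 0# < ε → x < x + ε
    x<x+ε {ε} x 0<ε = <-by 0<ε (solve 2 (λ x e → x :+ e :- x := e) refl x ε)

  totalOrder : TotalOrder 0ℓ 0ℓ 0ℓ
  totalOrder = record { isTotalOrder = isTotalOrder }

  open NaturalChoiceMin totalOrder public using (_⊓_; x⊓y≤x; x⊓y≤y; ⊓-sel)
  open NaturalChoiceMax totalOrder public using (_⊔_; x≤x⊔y; x≤y⊔x; ⊔-lub; ⊔-cong)

  abstract
    ⊓-pos : ∀ {x y} → 0# < x → 0# < y → 0# < x ⊓ y
    ⊓-pos {x} {y} 0<x 0<y with ⊓-sel x y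
    ... | inj₁ eq = <-respʳ-≈ (sym eq) 0<x
    ... | inj₂ eq = <-respʳ-≈ (sym eq) 0<y

-- Compactness and square roots

module Analysis (em : ExcludedMiddle 0ℓ) (ℝ : Reals) where
  open Reals ℝ hiding (zero)
  open OrderedField ℝ

  Near : Carrier → Carrier → Carrier → Set
  Near ε x y = x - y ≤ ε × y - x ≤ ε

  Antitone : {A : Set} → (A → Carrier → Set) → Set
  Antitone G = ∀ {x ε ε′} → ε′ ≤ ε → G x ε → G x ε′

  InBox : ∀ {k} → Vector Carrier k → Vector Carrier k → Vector Carrier k → Set
  InBox a b q = ∀ i → a i ≤ q i × q i ≤ b i

  halve : ℕ → Carrier → Carrier
  halve zero    D = D
  halve (suc r) D = halve r (½ * D)

  abstract
    near-mono : ∀ {ε ε′ x y} → ε ≤ ε′ → Near ε x y → Near ε′ x y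
    near-mono ε≤ε′ (p , q) = ≤-trans p ε≤ε′ , ≤-trans q ε≤ε′

    near-refl : ∀ {ε x y} → 0# ≤ ε → x ≈ y → Near ε x y
    near-refl {ε} {x} {y} 0≤ε x≈y =
      ≤-respˡ-≈ (sym (trans (+-congʳ x≈y) (-‿inverseʳ y))) 0≤ε ,
      ≤-respˡ-≈ (sym (trans (+-congˡ (-‿cong x≈y)) (-‿inverseʳ y))) 0≤ε

    near-cong : ∀ {ε x x′ y} → x ≈ x′ → Near ε x y → Near ε x′ y
    near-cong eq (p , q) = ≤-respˡ-≈ (+-congʳ eq) p , ≤-respˡ-≈ (+-congˡ (-‿cong eq)) q

    uniform : ∀ {k} (G : Fin k → Carrier → Set) → Antitone G →
              (∀ i → ∃ λ ε → 0# < ε × G i ε) → ∃ λ ε → 0# < ε × (∀ i → G i ε)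
    uniform {zero}  G anti each = 1# , 0<1 , λ ()
    uniform {suc k} G anti each
      with each zero | uniform (G ∘ suc) anti (each ∘ suc)
    ... | ε , 0<ε , g | ε′ , 0<ε′ , g′ = ε ⊓ ε′ , ⊓-pos 0<ε 0<ε′ , λ where
      zero    → anti (x⊓y≤x ε ε′) g
      (suc i) → anti (x⊓y≤y ε ε′) (g′ i)

    approach-supremum : ∀ {P : Pred Carrier 0ℓ} {s} → (∀ {b} → IsUpperBound P b → s ≤ b) →
                        ∀ {c} → c < s → ∃ λ t → P t × c < t
    approach-supremum {P} {s} least {c} c<s = decidable-stable em λ none →
      <-irrefl c<s (least λ {t} Pt → decidable-stable em λ t≰c → none (t , Pt , ≰⇒> t≰c))

  -- Heine-Borel by the supremum of those t for which one δ serves all of [a, t]. Since `H` is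
  -- antitone, a single ε can act both as the radius of a neighbourhood and as the bound valid on
  -- it.
  interval-compact : ∀ {a b} → a ≤ b → (H : Carrier → Carrier → Set) → Antitone H →
    (∀ t → a ≤ t → t ≤ b → ∃ λ ε → 0# < ε × (∀ s → Near ε s t → H s ε)) →
    ∃ λ δ → 0# < δ × (∀ s → a ≤ s → s ≤ b → H s δ)
  interval-compact {a} {b} a≤b H anti local =
    let (u , u≈b , δ , 0<δ , h) = reach-b in
    δ , 0<δ , λ s a≤s s≤b → h s a≤s (≤-respʳ-≈ (sym u≈b) s≤b)
    where
    P : Pred Carrier 0ℓ
    P t = (a ≤ t × t ≤ b) × ∃ λ δ → 0# < δ × (∀ s → a ≤ s → s ≤ t → H s δ)

    Pa : P a
    Pa with local a ≤-refl a≤b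
    ... | ε , 0<ε , h = (≤-refl , a≤b) , ε , 0<ε , λ s a≤s s≤a →
      h s (near-refl (<⇒≤ 0<ε) (≤-antisym s≤a a≤s))

    sup : ∃ λ s → IsUpperBound P s × (∀ {b} → IsUpperBound P b → s ≤ b)
    sup = supremum P (a , Pa) (b , λ Px → proj₂ (proj₁ Px))

    s* : Carrier
    s* = proj₁ sup

    s*≤b : s* ≤ b
    s*≤b = proj₂ (proj₂ sup) (λ Px → proj₂ (proj₁ Px))

    reach-b : ∃ λ u → u ≈ b × ∃ λ δ → 0# < δ × (∀ s → a ≤ s → s ≤ u → H s δ)
    reach-b with local s* (proj₁ (proj₂ sup) Pa) s*≤b
    ... | ε , 0<ε , h with approach-supremum {P} (proj₂ (proj₂ sup)) (x-ε<x s* 0<ε)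
    ... | t , Pt@((a≤t , t≤b) , δ , 0<δ , ht) , s*-ε<t = u , u≈b , δ ⊓ ε , ⊓-pos 0<δ 0<ε , hu
      where
      -- One δ still serves up to this point, so it cannot exceed `s*`; the cut-off at b must
      -- therefore be active.
      u : Carrier
      u = (s* + ε) ⊓ b

      hu : ∀ s → a ≤ s → s ≤ u → H s (δ ⊓ ε)
      hu s a≤s s≤u with total s t
      ... | inj₁ s≤t = anti (x⊓y≤x δ ε) (ht s a≤s s≤t)
      ... | inj₂ t≤s = anti (x⊓y≤y δ ε) (h s
        ( ≤-by (gap (≤-trans s≤u (x⊓y≤x _ _)))
            (solve 3 (λ s x e → e :- (s :- x) := x :+ e :- s) refl s s* ε)
        , ≤-by (gap (≤-trans (<⇒≤ s*-ε<t) t≤s))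
            (solve 3 (λ s x e → e :- (x :- s) := s :- (x :- e)) refl s s* ε)))

      t≤u : t ≤ u
      t≤u with ⊓-sel (s* + ε) b
      ... | inj₁ eq = ≤-respʳ-≈ (sym eq) (≤-trans (proj₁ (proj₂ sup) Pt)
                        (<⇒≤ (x<x+ε s* 0<ε)))
      ... | inj₂ eq = ≤-respʳ-≈ (sym eq) t≤b

      u≤s* : u ≤ s*
      u≤s* = proj₁ (proj₂ sup) ((≤-trans a≤t t≤u , x⊓y≤y _ _) , δ ⊓ ε , ⊓-pos 0<δ 0<ε , hu)

      u≈b : u ≈ b
      u≈b with ⊓-sel (s* + ε) b
      ... | inj₂ eq = eq
      ... | inj₁ eq = contradiction (≤-respˡ-≈ eq u≤s*)
                        (<-irrefl (x<x+ε s* 0<ε))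

  -- A tube lemma: for fixed t, compactness in the other coordinates gives one δ on a thickened
  -- slice around t, and `interval-compact` then makes it uniform in t. `Slice` and `Thick` range
  -- over whole vectors, matched up to `_≈_`, so that `G` is never transported along an equality.
  box-compact : ∀ {k} (a b : Vector Carrier k) → (∀ i → a i ≤ b i) →
    (G : Vector Carrier k → Carrier → Set) → Antitone G →
    (∀ p → InBox a b p → ∃ λ ε → 0# < ε ×
        (∀ q → InBox a b q → (∀ i → Near ε (q i) (p i)) → G q ε)) →
    ∃ λ δ → 0# < δ × (∀ q → InBox a b q → G q δ)
  box-compact {zero} a b a≤b G anti local with local (λ ()) (λ ())
  ... | ε , 0<ε , g = ε , 0<ε , λ q _ → g q (λ ()) (λ ())
  box-compact {suc k} a b a≤b G anti local =
    let (δ , 0<δ , h) = interval-compact (a≤b zero) Slice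
          (λ ε′≤ε h q q∈ eq → anti ε′≤ε (h q q∈ eq)) slice
    in δ , 0<δ , λ q q∈ → h (head q) (proj₁ (q∈ zero)) (proj₂ (q∈ zero)) q q∈ refl
    where
    Slice : Carrier → Carrier → Set
    Slice t ε = ∀ q → InBox a b q → head q ≈ t → G q ε

    module _ (t : Carrier) (a≤t : a zero ≤ t) (t≤b : t ≤ b zero) where
      Thick : Vector Carrier k → Carrier → Set
      Thick q′ ε = ∀ q → InBox a b q → Near ε (head q) t → (∀ i → tail q i ≈ q′ i) → G q ε

      thick : ∀ p′ → InBox (tail a) (tail b) p′ → ∃ λ ε → 0# < ε ×
              (∀ q′ → InBox (tail a) (tail b) q′ → (∀ i → Near ε (q′ i) (p′ i)) → Thick q′ ε)
      thick p′ p′∈ =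
        let (ε , 0<ε , g) = local (t Vector.∷ p′) (λ { zero → a≤t , t≤b ; (suc i) → p′∈ i })
        in ε , 0<ε , λ q′ _ near′ q q∈ near eq → g q q∈
             (λ { zero → near ; (suc i) → near-cong (sym (eq i)) (near′ i) })

      slice : ∃ λ ε → 0# < ε × (∀ s → Near ε s t → Slice s ε)
      slice =
        let (δ , 0<δ , g) = box-compact (tail a) (tail b) (λ i → a≤b (suc i)) Thick
              (λ ε′≤ε g q q∈ near eq → anti ε′≤ε (g q q∈ (near-mono ε′≤ε near) eq)) thick
        in δ , 0<δ , λ s near q q∈ q₀≈s →
             g (tail q) (λ i → q∈ (suc i)) q q∈ (near-cong (sym q₀≈s) near) (λ _ → refl)

  abstract
    double : ∀ {x y} → x ≤ ½ * y → x + x ≤ y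
    double {x} {y} x≤½y = ≤-respʳ-≈ (halves y) (+-mono-≤ x≤½y x≤½y)

    -- Otherwise the lower bounds of the sequence D, D/2, D/4, ... would have a
    -- positive supremum s, and 2s would be one of them.
    halve-small : ∀ {D δ} → 0# < δ → ∃ λ r → halve r D ≤ δ
    halve-small {D} {δ} 0<δ = decidable-stable em λ none → impossible λ r →
      <⇒≤ (≰⇒> λ small → none (r , small))
      where
      halve-* : ∀ r D → halve r (½ * D) ≈ ½ * halve r D
      halve-* zero    D = refl
      halve-* (suc r) D = halve-* r (½ * D)

      P : Pred Carrier 0ℓ
      P x = ∀ r → x ≤ halve r D

      impossible : ¬ P δ
      impossible Pδ with supremum P (δ , Pδ) (D , λ Px → Px 0)
      ... | s , upper , least = <-irrefl (<-≤-trans 0<δ (upper Pδ))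
        (≤-by (gap (upper {s + s} (λ r → double
            (≤-respʳ-≈ (halve-* r D) (least (λ Px → Px (suc r)))))))
          (solve 1 (λ s → :0 :- s := s :- (s :+ s)) refl s))

    square-mono-≤ : ∀ {x y} → 0# ≤ x → x ≤ y → x * x ≤ y * y
    square-mono-≤ {x} {y} 0≤x x≤y = ≤-by (*-nonNeg (gap x≤y) (+-nonNeg 0≤x (≤-trans 0≤x x≤y)))
      (solve 2 (λ x y → y :* y :- x :* x := (y :- x) :* (x :+ y)) refl x y)

    square-mono-< : ∀ {x y} → 0# ≤ x → x < y → x * x < y * y
    square-mono-< {x} {y} 0≤x x<y = <-by
        (*-pos (gap-< x<y) (<-respʳ-≈ (+-comm y x) (+-posˡ (≤-<-trans 0≤x x<y) 0≤x)))
      (solve 2 (λ x y → y :* y :- x :* x := (y :- x) :* (x :+ y)) refl x y)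

    small-multiple : ∀ {x y} → 0# < x → 0# < y → ∃ λ e → 0# < e × e ≤ 1# × e * x ≤ y
    small-multiple {x} {y} 0<x 0<y with pos-inverse 0<x
    ... | x⁻¹ , 0<x⁻¹ , xx⁻¹≈1 = e , ⊓-pos 0<1 (*-pos 0<y 0<x⁻¹) , x⊓y≤x _ _ ,
      ≤-by (*-nonNeg (gap (x⊓y≤y 1# (y * x⁻¹))) (<⇒≤ 0<x))
        (trans (+-congʳ (trans (sym (*-identityʳ y)) (*-congˡ (sym xx⁻¹≈1))))
          (solve 4 (λ x y x⁻¹ e → y :* (x :* x⁻¹) :- e :* x := (y :* x⁻¹ :- e) :* x) refl x y
              x⁻¹ e))
      where
      e : Carrier
      e = 1# ⊓ (y * x⁻¹)

    -- Let c be the supremum of the x with x * x ≤ s. Were c * c too large, a slightly smaller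
    -- number would still be an upper bound; were it too small, a slightly larger number would still
    -- have its square below s. The size of the step comes from `small-multiple`.
    sqrt : ∀ {s} → 1# ≤ s → ∃ λ c → 1# ≤ c × c * c ≈ s
    sqrt {s} 1≤s = c , 1≤c , ≤-antisym (decidable-stable em c²≰s-absurd)
        (decidable-stable em s≰c²-absurd)
      where
      P : Pred Carrier 0ℓ
      P x = x * x ≤ s

      0≤s : 0# ≤ s
      0≤s = ≤-trans (<⇒≤ 0<1) 1≤s

      upper-bound : ∀ {t} → 0# ≤ t → s ≤ t * t → IsUpperBound P t
      upper-bound 0≤t s≤t² x²≤s = decidable-stable em λ x≰t →
        <-irrefl (square-mono-< 0≤t (≰⇒> x≰t)) (≤-trans x²≤s s≤t²)

      P1 : P 1#
      P1 = ≤-respˡ-≈ (sym (*-identityʳ 1#)) 1≤s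

      sup : ∃ λ c → IsUpperBound P c × (∀ {b} → IsUpperBound P b → c ≤ b)
      sup = supremum P (1# , P1) (s , upper-bound {s} 0≤s
        (≤-by (*-nonNeg 0≤s (gap 1≤s)) (solve 1 (λ s → s :* s :- s := s :* (s :- :1)) refl s)))

      c : Carrier
      c = proj₁ sup

      1≤c : 1# ≤ c
      1≤c = proj₁ (proj₂ sup) P1

      0<c : 0# < c
      0<c = <-≤-trans 0<1 1≤c

      shrink : ∀ e → (c - e) * (c - e) - s ≈ (c * c - s) - e * (c + c) + e * e
      shrink e = solve 3 (λ c e s → (c :- e) :* (c :- e) :- s := (c :* c :- s) :- e :*
          (c :+ c) :+ e :* e) refl c e s

      grow : ∀ e → s - (c + e) * (c + e) ≈ (s - c * c) - e * (c + c + 1#) + e * (1# - e)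
      grow e = solve 3 (λ c e s → s :- (c :+ e) :* (c :+ e) := (s :- c :* c) :- e :*
          (c :+ c :+ :1) :+ e :* (:1 :- e)) refl c e s

      c²≰s-absurd : ¬ ¬ (c * c ≤ s)
      c²≰s-absurd c²≰s =
        let (e , 0<e , e≤1 , bound) = small-multiple (+-pos 0<c 0<c) (gap-< (≰⇒> c²≰s)) in
        <-irrefl (x-ε<x c 0<e) (proj₂ (proj₂ sup) {c - e}
            (upper-bound {c - e} (gap (≤-trans e≤1 1≤c))
          (≤-by (+-nonNeg (gap bound) (square-nonNeg e)) (shrink e))))

      s≰c²-absurd : ¬ ¬ (s ≤ c * c)
      s≰c²-absurd s≰c² =
        let (e , 0<e , e≤1 , bound) = small-multiple (+-pos (+-pos 0<c 0<c) 0<1)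
                (gap-< (≰⇒> s≰c²)) in
        <-irrefl (x<x+ε c 0<e) (proj₁ (proj₂ sup) {c + e}
          (≤-by (+-nonNeg (gap bound) (*-nonNeg (<⇒≤ 0<e) (gap e≤1))) (grow e)))

-- The sphere

module SphereGeometry (em : ExcludedMiddle 0ℓ) (ℝ : Reals) (d : ℕ) where
  open Reals ℝ hiding (zero)
  open OrderedField ℝ
  open Analysis em ℝ
  open UnitSphere ℝ d
  open CommutativeMonoidSum +-commutativeMonoid using (sum-cong-≋; ∑-distrib-+)
  open SemiringSum semiring using (*-distribˡ-sum)

  -- The bound c ≥ 1 makes the radial projection nonexpanding.
  _projectsTo_ : Vector Carrier (suc d) → Sphere → Set
  v projectsTo x = ∃ λ c → 1# ≤ c × (∀ i → v i ≈ c * coord x i)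

  negate : Sphere → Sphere
  negate (x , ‖x‖²≈1) = (λ i → - x i) ,
    trans (sum-cong-≋ (λ i → solve 1 (λ x → :- x :* :- x := x :* x) refl (x i))) ‖x‖²≈1

  abstract
    norm-cong : ∀ {k} {u v : Vector Carrier k} → (∀ i → u i ≈ v i) → ‖ u ‖² ≈ ‖ v ‖²
    norm-cong u≈v = sum-cong-≋ (λ i → *-cong (u≈v i) (u≈v i))

    norm-nonNeg : ∀ {k} (v : Vector Carrier k) → 0# ≤ ‖ v ‖²
    norm-nonNeg {zero}  v = ≤-refl
    norm-nonNeg {suc k} v = +-nonNeg (square-nonNeg (v zero)) (norm-nonNeg (v ∘ suc))

    square≤norm : ∀ {k} (v : Vector Carrier k) i → v i * v i ≤ ‖ v ‖²
    square≤norm v zero    = ≤-by (norm-nonNeg (v ∘ suc))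
        (difference (v zero * v zero) ‖ v ∘ suc ‖²)
      where
      difference : ∀ a b → a + b - a ≈ b
      difference = solve 2 (λ a b → a :+ b :- a := b) refl
    square≤norm v (suc i) = ≤-trans (square≤norm (v ∘ suc) i)
      (≤-by (square-nonNeg (v zero)) (difference (v zero * v zero) ‖ v ∘ suc ‖²))
      where
      difference : ∀ a b → a + b - b ≈ a
      difference = solve 2 (λ a b → a :+ b :- b := a) refl

    norm-zero : ∀ {k} (v : Vector Carrier k) → (∀ i → v i ≈ 0#) → ‖ v ‖² ≈ 0#
    norm-zero {zero}  v v≈0 = refl
    norm-zero {suc k} v v≈0 = trans
      (+-cong (trans (*-congʳ (v≈0 zero)) (zeroˡ _)) (norm-zero (v ∘ suc) (v≈0 ∘ suc)))
          (+-identityˡ 0#)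

    nonzero : ∀ (x : Sphere) → ¬ (∀ i → coord x i ≈ 0#)
    nonzero (x , ‖x‖²≈1) x≈0 = 0≉1 (trans (sym (norm-zero x x≈0)) ‖x‖²≈1)

    coordinate-near : ∀ {x y ε} → 0# < ε → dist² x y < ε * ε →
                      ∀ i → Near ε (coord y i) (coord x i)
    coordinate-near {x} {y} {ε} 0<ε close i = bound (y-x i) , bound refl
      where
      u : Vector Carrier (suc d)
      u i = coord x i - coord y i
      y-x : ∀ i → (coord y i - coord x i) * (coord y i - coord x i) ≈ u i * u i
      y-x i = solve 2 (λ x y → (y :- x) :* (y :- x) := (x :- y) :* (x :- y)) refl (coord x i)
          (coord y i)
      bound : ∀ {a} → a * a ≈ u i * u i → a ≤ ε
      bound {a} eq = decidable-stable em λ a≰ε → <-irrefl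
        (≤-<-trans (≤-trans (≤-reflexive eq) (square≤norm u i)) close)
        (square-mono-≤ (<⇒≤ 0<ε) (<⇒≤ (≰⇒> a≰ε)))

    -- One coordinate and the norm of the rest may each use up ε/2, because two squares of ε/2 add
    -- up to at most the square of ε.
    small-norm : ∀ k {ε} → 0# < ε → ∃ λ η → 0# < η ×
                 (∀ (u : Vector Carrier k) → (∀ i → - η ≤ u i × u i ≤ η) → ‖ u ‖² < ε * ε)
    small-norm zero    {ε} 0<ε = ε , 0<ε , λ u _ → *-pos 0<ε 0<ε
    small-norm (suc k) {ε} 0<ε =
      let (η , 0<η , small) = small-norm k (half-pos 0<ε)
          h = ½ * ε
          μ = η ⊓ h
          μ≤η = x⊓y≤x η h
          μ≤h = x⊓y≤y η h
      in μ , ⊓-pos 0<η (half-pos 0<ε) , λ u u-small →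
         <-≤-trans
           (≤-<-trans (+-mono-≤ (square-≤ (≤-trans (neg-mono-≤ μ≤h) (proj₁ (u-small zero)))
               (≤-trans (proj₂ (u-small zero)) μ≤h)) ≤-refl)
             (+-monoʳ-< (h * h) (small (u ∘ suc) (λ i →
               ≤-trans (neg-mono-≤ μ≤η) (proj₁ (u-small (suc i))) ,
               ≤-trans (proj₂ (u-small (suc i))) μ≤η))))
           (two-squares (<⇒≤ (half-pos 0<ε)))
      where
      square-≤ : ∀ {a b} → - b ≤ a → a ≤ b → a * a ≤ b * b
      square-≤ {a} {b} -b≤a a≤b = ≤-by (*-nonNeg (gap -b≤a) (gap a≤b))
        (solve 2 (λ a b → b :* b :- a :* a := (a :- :- b) :* (b :- a)) refl a b)
      +-monoʳ-< : ∀ x {y z} → y < z → x + y < x + z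
      +-monoʳ-< x {y} {z} y<z = <-by (gap-< y<z)
          (solve 3 (λ x y z → x :+ z :- (x :+ y) := z :- y) refl x y z)
      two-squares : 0# ≤ ½ * ε → ½ * ε * (½ * ε) + ½ * ε * (½ * ε) ≤ ε * ε
      two-squares 0≤h = ≤-trans
        (≤-by (+-nonNeg (square-nonNeg (½ * ε)) (square-nonNeg (½ * ε)))
          (solve 1 (λ h → (h :+ h) :* (h :+ h) :- (h :* h :+ h :* h) := h :* h :+ h :* h) refl
              (½ * ε)))
        (≤-reflexive (*-cong (halves ε) (halves ε)))

    -- ‖cx - c′y‖² = (c - c′)² + cc′‖x - y‖² for unit vectors x and y.
    projection-contracts : ∀ {v w x y} → v projectsTo x → w projectsTo y →
                           dist² x y ≤ ‖ (λ i → v i - w i) ‖²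
    projection-contracts {v} {w} {x , ‖x‖²≈1} {y , ‖y‖²≈1} (c , 1≤c , v≈cx)
        (c′ , 1≤c′ , w≈c′y) =
      ≤-trans (≤-by (*-nonNeg (scale≥1 1≤c 1≤c′) (norm-nonNeg (λ i → x i - y i)))
          (difference _ _))
        (≤-trans (≤-by (square-nonNeg (c - c′)) (add-sub _ _)) (≤-reflexive (sym total-norm)))
      where
      D : Carrier
      D = ‖ (λ i → x i - y i) ‖²

      scale≥1 : ∀ {a b} → 1# ≤ a → 1# ≤ b → 0# ≤ a * b - 1#
      scale≥1 {a} {b} 1≤a 1≤b = ≤-respʳ-≈
        (solve 2 (λ a b → (a :- :1) :* (b :- :1) :+ ((a :- :1) :+ (b :- :1)) := a :* b :- :1)
            refl a b)
        (+-nonNeg (*-nonNeg (gap 1≤a) (gap 1≤b)) (+-nonNeg (gap 1≤a) (gap 1≤b)))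

      difference : ∀ a b → a * b - b ≈ (a - 1#) * b
      difference = solve 2 (λ a b → a :* b :- b := (a :- :1) :* b) refl

      add-sub : ∀ a b → a + b - b ≈ a
      add-sub = solve 2 (λ a b → a :+ b :- b := a) refl

      -- The coefficients left at x * x and y * y once the cross term is absorbed into c * c′ times
      -- the square of x - y. Their sum is the square of c - c′.
      A B : Carrier
      A = c * c - c * c′
      B = c′ * c′ - c * c′

      pointwise : ∀ x y → (c * x - c′ * y) * (c * x - c′ * y) ≈
                          A * (x * x) + B * (y * y) + c * c′ * ((x - y) * (x - y))
      pointwise x y = solve 4 (λ c c′ x y → (c :* x :- c′ :* y) :* (c :* x :- c′ :* y)
        := (c :* c :- c :* c′) :* (x :* x) :+ (c′ :* c′ :- c :* c′) :* (y :* y) :+ c :* c′ :*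
            ((x :- y) :* (x :- y)))
        refl c c′ x y

      combine : ∀ e → A * 1# + B * 1# + c * c′ * e ≈ (c - c′) * (c - c′) + c * c′ * e
      combine e = solve 3 (λ c c′ e → (c :* c :- c :* c′) :* :1 :+
          (c′ :* c′ :- c :* c′) :* :1 :+ c :* c′ :* e
        := (c :- c′) :* (c :- c′) :+ c :* c′ :* e) refl c c′ e

      total-norm : ‖ (λ i → v i - w i) ‖² ≈ (c - c′) * (c - c′) + c * c′ * D
      total-norm = begin
        ‖ (λ i → v i - w i) ‖²
          ≈⟨ norm-cong (λ i → +-cong (v≈cx i) (-‿cong (w≈c′y i))) ⟩
        ‖ (λ i → c * x i - c′ * y i) ‖²
          ≈⟨ sum-cong-≋ (λ i → pointwise (x i) (y i)) ⟩
        sum (λ i → A * (x i * x i) + B * (y i * y i) + c * c′ * ((x i - y i) * (x i - y i)))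
          ≈⟨ ∑-distrib-+ (λ i → A * (x i * x i) + B * (y i * y i))
              (λ i → c * c′ * ((x i - y i) * (x i - y i))) ⟩
        sum (λ i → A * (x i * x i) + B * (y i * y i)) +
        sum (λ i → c * c′ * ((x i - y i) * (x i - y i)))
          ≈⟨ +-cong (∑-distrib-+ (λ i → A * (x i * x i)) (λ i → B * (y i * y i)))
              (sym (*-distribˡ-sum (c * c′) (λ i → (x i - y i) * (x i - y i)))) ⟩
        sum (λ i → A * (x i * x i)) + sum (λ i → B * (y i * y i)) + c * c′ * D
          ≈⟨ +-congʳ (+-cong (*-distribˡ-sum A (λ i → x i * x i))
              (*-distribˡ-sum B (λ i → y i * y i))) ⟨
        A * ‖ x ‖² + B * ‖ y ‖² + c * c′ * D
          ≈⟨ +-congʳ (+-cong (*-congˡ ‖x‖²≈1) (*-congˡ ‖y‖²≈1)) ⟩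
        A * 1# + B * 1# + c * c′ * D
          ≈⟨ combine D ⟩
        (c - c′) * (c - c′) + c * c′ * D ∎
        where open import Relation.Binary.Reasoning.Setoid setoid

    project : ∀ v → 1# ≤ ‖ v ‖² → ∃ (v projectsTo_)
    project v 1≤‖v‖² =
      let (c , 1≤c , c²≈‖v‖²) = sqrt 1≤‖v‖²
          (c⁻¹ , _ , cc⁻¹≈1) = pos-inverse (<-≤-trans 0<1 1≤c)
      in ((λ i → c⁻¹ * v i) ,
          trans (sum-cong-≋ (λ i → square-of-product c⁻¹ (v i)))
            (trans (sym (*-distribˡ-sum (c⁻¹ * c⁻¹) (λ i → v i * v i)))
              (trans (*-congˡ (sym c²≈‖v‖²))
                (trans (sym (square-of-product′ c c⁻¹))
                    (trans (*-cong cc⁻¹≈1 cc⁻¹≈1) (*-identityʳ 1#)))))) ,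
         c , 1≤c , λ i → trans (sym (*-identityˡ (v i)))
             (trans (*-congʳ (sym cc⁻¹≈1)) (*-assoc c c⁻¹ (v i)))
      where
      square-of-product : ∀ a b → a * b * (a * b) ≈ a * a * (b * b)
      square-of-product = solve 2 (λ a b → a :* b :* (a :* b) := a :* a :* (b :* b)) refl
      square-of-product′ : ∀ a b → a * b * (a * b) ≈ b * b * (a * a)
      square-of-product′ = solve 2 (λ a b → a :* b :* (a :* b) := b :* b :* (a :* a)) refl

-- The upper bound

module Gale (em : ExcludedMiddle 0ℓ) (ℝ : Reals) where
  open Reals ℝ hiding (zero; _≉_)
  open OrderedField ℝ
  open Analysis em ℝ

  -- The i-th value of the polynomial with coordinates a in the Newton basis
  -- binomial(i, 0), binomial(i, 1), …; dropping the first coordinate takes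
  -- the difference sequence.
  newton : ∀ {k} → Vector Carrier k → ℕ → Carrier
  newton {zero}  a i       = 0#
  newton {suc k} a zero    = head a
  newton {suc k} a (suc i) = newton a i + newton (tail a) i

  signed : Bool → Carrier → Carrier
  signed true  x = x
  signed false x = - x

  -- A subsequence of length k of f with weakly alternating signs, the first
  -- of which is opposite to s.
  data Alternation : Bool → ℕ → (ℕ → Carrier) → Set where
    done : ∀ {s f} → Alternation s 0 f
    take : ∀ {s k f} → signed s (f 0) ≤ 0# → Alternation (not s) k (f ∘ suc) →
           Alternation s (suc k) f
    skip : ∀ {s k f} → Alternation s k (f ∘ suc) → Alternation s k f

  parity : Bool → ℕ → Bool
  parity s zero    = s
  parity s (suc i) = parity (not s) i

  abstract
    signed-not : ∀ s x → signed (not s) x ≈ - signed s x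
    signed-not true  x = refl
    signed-not false x = solve 1 (λ x → x := :- :- x) refl x

    signed-cong : ∀ s {x y} → x ≈ y → signed s x ≈ signed s y
    signed-cong true  eq = eq
    signed-cong false eq = -‿cong eq

    signed-+ : ∀ s x y → signed s (x + y) ≈ signed s x + signed s y
    signed-+ true  x y = refl
    signed-+ false x y = solve 2 (λ x y → :- (x :+ y) := :- x :- y) refl x y

    signed-neg : ∀ s x → signed s (- x) ≈ - signed s x
    signed-neg true  x = refl
    signed-neg false x = refl

    opposite-signs : ∀ s {x} → signed s x ≤ 0# → signed (not s) x ≤ 0# → x ≈ 0#
    opposite-signs true {x} x≤0 -x≤0 = ≤-antisym x≤0
        (≤-by (gap -x≤0) (solve 1 (λ x → x :- :0 := :0 :- :- x) refl x))
    opposite-signs false {x} -x≤0 x≤0 = ≤-antisym x≤0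
        (≤-by (gap -x≤0) (solve 1 (λ x → x :- :0 := :0 :- :- x) refl x))

    step-down : ∀ s {x y z} → z ≈ x + y → signed s x ≤ 0# → signed (not s) z ≤ 0# →
                signed (not s) y ≤ 0#
    step-down s {x} {y} {z} z≈x+y sx≤0 s̄z≤0 = ≤-by (+-nonNeg (gap sx≤0) (gap s̄z≤0))
      (trans (identity (signed s x) (signed (not s) y)) (+-congˡ (+-congˡ (-‿cong (sym s̄z)))))
      where
      s̄z : signed (not s) z ≈ - signed s x + signed (not s) y
      s̄z = trans (signed-cong (not s) z≈x+y)
          (trans (signed-+ (not s) x y) (+-congʳ (signed-not s x)))
      identity : ∀ a b → 0# - b ≈ 0# - a + (0# - (- a + b))
      identity = solve 2 (λ a b → :0 :- b := :0 :- a :+ (:0 :- (:- a :+ b))) refl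

    step-up : ∀ s {x y z} → z ≈ x + y → signed s x ≤ 0# → 0# ≤ signed (not s) y →
              signed s z ≤ 0#
    step-up s {x} {y} {z} z≈x+y sx≤0 0≤s̄y = ≤-by (+-nonNeg (gap sx≤0) 0≤s̄y)
      (trans (+-congˡ (-‿cong (trans (signed-cong s z≈x+y) (signed-+ s x y))))
        (trans (identity (signed s x) (signed s y)) (+-congˡ (sym (signed-not s y)))))
      where
      identity : ∀ a b → 0# - (a + b) ≈ 0# - a + - b
      identity = solve 2 (λ a b → :0 :- (a :+ b) := :0 :- a :+ :- b) refl

  -- Discrete Rolle: f decreases somewhere between a weakly positive and a
  -- later weakly negative value.
  rolle  : ∀ {s k f g} → (∀ i → f (suc i) ≈ f i + g i) →
           Alternation s (suc k) f → Alternation (not s) k g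
  rolle′ : ∀ {s k f g} → (∀ i → f (suc i) ≈ f i + g i) → signed s (f 0) ≤ 0# →
           Alternation (not s) (suc k) (f ∘ suc) → Alternation (not s) (suc k) g
  rolle {k = zero}  step alt          = done
  rolle {k = suc k} step (skip alt)   = skip (rolle (step ∘ suc) alt)
  rolle {k = suc k} step (take p alt) = rolle′ step p alt
  rolle′ {s} step p alt@(take q _) = take (step-down s (step 0) p q) (rolle (step ∘ suc) alt)
  rolle′ {s} {g = g} step p (skip alt) with total (signed (not s) (g 0)) 0#
  ... | inj₁ neg = take neg (rolle (step ∘ suc) (skip alt))
  -- Here `f 1` has the weak sign of `f 0` and takes its place in the search.
  ... | inj₂ pos = skip (rolle′ (step ∘ suc) (step-up s (step 0) p pos) alt)

  first : ∀ {s k f} → Alternation s (suc k) f →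
          ∃ λ i → signed s (f i) ≤ 0# × Alternation (not s) k (λ j → f (suc (i ℕ.+ j)))
  first (take p alt) = 0 , p , alt
  first (skip alt)   = let (i , p , alt′) = first alt in suc i , p , alt′

  shorten : ∀ {s k f} → Alternation s (suc k) f → Alternation s k f
  shorten {k = zero}  alt          = done
  shorten {k = suc k} (take p alt) = take p (shorten alt)
  shorten {k = suc k} (skip alt)   = skip (shorten alt)

  shorten-≤ : ∀ {s k l f} → k ℕ.≤′ l → Alternation s l f → Alternation s k f
  shorten-≤ ℕ.≤′-refl       alt = alt
  shorten-≤ (ℕ.≤′-step k≤l) alt = shorten-≤ k≤l (shorten alt)

  newton-zero : ∀ {k} (a : Vector Carrier k) → (∀ i → a i ≈ 0#) → ∀ i → newton a i ≈ 0#
  newton-zero {zero}  a a≈0 i       = refl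
  newton-zero {suc k} a a≈0 zero    = a≈0 zero
  newton-zero {suc k} a a≈0 (suc i) =
    trans (+-cong (newton-zero a a≈0 i) (newton-zero (tail a) (a≈0 ∘ suc) i)) (+-identityˡ 0#)

  newton-neg : ∀ {k} (a b : Vector Carrier k) → (∀ i → b i ≈ - a i) → ∀ i →
      newton b i ≈ - newton a i
  newton-neg {zero}  a b b≈-a i       = solve 0 (:0 := :- :0) refl
  newton-neg {suc k} a b b≈-a zero    = b≈-a zero
  newton-neg {suc k} a b b≈-a (suc i) =
    trans (+-cong (newton-neg a b b≈-a i) (newton-neg (tail a) (tail b) (b≈-a ∘ suc) i))
      (solve 2 (λ x y → :- x :- y := :- (x :+ y)) refl (newton a i) (newton (tail a) i))

  constant : ∀ {k} (a : Vector Carrier (suc k)) → (∀ i → tail a i ≈ 0#) → ∀ i →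
      newton a i ≈ head a
  constant a a≈0 zero    = refl
  constant a a≈0 (suc i) = trans (+-cong (constant a a≈0 i) (newton-zero (tail a) a≈0 i))
      (+-identityʳ _)

  -- By `rolle` the difference sequence alternates one step less, so by induction its coordinates
  -- vanish. The sequence is then constant, and two of its values have opposite weak signs.
  long-alternation : ∀ {k s} (a : Vector Carrier k) → Alternation s (suc k) (newton a) → ∀ i →
      a i ≈ 0#
  long-alternation {suc k} {s} a alt = λ { zero → head≈0 ; (suc i) → tail≈0 i }
    where
    tail≈0 : ∀ i → tail a i ≈ 0#
    tail≈0 = long-alternation (tail a) (rolle (λ _ → refl) alt)

    value : ∀ s i → signed s (newton a i) ≤ 0# → signed s (head a) ≤ 0#
    value s i = ≤-respˡ-≈ (signed-cong s (constant a tail≈0 i))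

    head≈0 : head a ≈ 0#
    head≈0 =
      let (i , p , alt′) = first alt
          (j , q , _)    = first alt′
      in opposite-signs s (value s i p) (value (not s) (suc (i ℕ.+ j)) q)

  two-more : ∀ l k → suc (suc (l ℕ.+ (k ℕ.+ k))) ≡ l ℕ.+ (suc k ℕ.+ suc k)
  two-more l k = ≡.sym (≡.trans (≡.cong (λ m → l ℕ.+ suc m) (ℕ.+-suc k k))
    (≡.trans (ℕ.+-suc l _) (≡.cong suc (ℕ.+-suc l _))))

  -- A positive term is skipped together with its successor, so that the signs
  -- asked for stay in step with the parity.
  scan : ∀ M s (f : ℕ → Carrier) → ∃ λ (J : Subset M) → ∃ λ l → M ℕ.≤ l ℕ.+ (∣ J ∣ ℕ.+ ∣ J ∣) ×
         (∀ j → j ∈ₛ J → 0# < signed (parity s (toℕ j)) (f (toℕ j))) × Alternation s l f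
  scan zero s f = [] , 0 , ℕ.z≤n , (λ _ ()) , done
  scan (suc M) s f = split M em
    where
    split : ∀ M → Dec (signed s (f 0) ≤ 0#) →
            ∃ λ (J : Subset (suc M)) → ∃ λ l → suc M ℕ.≤ l ℕ.+ (∣ J ∣ ℕ.+ ∣ J ∣) ×
            (∀ j → j ∈ₛ J → 0# < signed (parity s (toℕ j)) (f (toℕ j))) × Alternation s l f
    split M (yes p) =
      let (J , l , bound , pos , alt) = scan M (not s) (f ∘ suc)
      in outside ∷ J , suc l , ℕ.s≤s bound , (λ { (suc j) (there j∈J) → pos j j∈J }) ,
          take p alt
    -- A positive last term has no successor to skip; the bound 1 ≤ 0 + 2 has room for that.
    split zero (no ¬p) = inside ∷ [] , 0 , ℕ.s≤s ℕ.z≤n , (λ { zero here → ≰⇒> ¬p }) , done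
    split (suc M) (no ¬p) =
      let (J , l , bound , pos , alt) = scan M (not (not s)) (λ i → f (suc (suc i)))
      in inside ∷ outside ∷ J , l ,
         ℕ.≤-trans (ℕ.s≤s (ℕ.s≤s bound)) (ℕ.≤-reflexive (two-more l ∣ J ∣)) ,
         (λ { zero here → ≰⇒> ¬p ; (suc (suc j)) (there (there j∈J)) → pos j j∈J }) ,
         skip (skip (≡.subst (λ t → Alternation t l (λ i → f (suc (suc i))))
             (not-involutive s) alt))

  module UpperBound (d : ℕ) where
    open UnitSphere ℝ d
    open SphereGeometry em ℝ d

    value : Sphere → ℕ → Carrier
    value x = newton (coord x)

    -- The open hemisphere around the vector with coordinates binomial(i, 0), ..., binomial(i, d),
    -- taken with the sign of (-1)^i.
    Gale-set : ∀ {M} → Fin M → Pred Sphere 0ℓ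
    Gale-set i x = 0# < signed (parity true (toℕ i)) (value x (toℕ i))

    Gale-cover : ∀ n x → CoveredAtLeast n (Gale-set {d ℕ.+ (n ℕ.+ n)}) x
    Gale-cover n x =
      let (J , l , bound , pos , alt) = scan (d ℕ.+ (n ℕ.+ n)) true (value x)
      -- With fewer than n elements in `J`, the bound leaves l ≥ d + 2: an alternation long enough
      -- to annihilate all d + 1 coordinates of x.
      in J , ℕ.≮⇒≥ (λ J<n → nonzero x (long-alternation (coord x)
               (shorten-≤ (ℕ.≤⇒≤′ (counting l ∣ J ∣ bound J<n)) alt))) , pos
      where
      open ℕ.≤-Reasoning
      counting : ∀ l j → d ℕ.+ (n ℕ.+ n) ℕ.≤ l ℕ.+ (j ℕ.+ j) → j ℕ.< n → suc (suc d) ℕ.≤ l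
      counting l j bound j<n = ℕ.+-cancelʳ-≤ (j ℕ.+ j) (suc (suc d)) l (begin
        suc (suc (d ℕ.+ (j ℕ.+ j)))     ≡⟨ two-more d j ⟩
        d ℕ.+ (suc j ℕ.+ suc j)         ≤⟨ ℕ.+-monoʳ-≤ d (ℕ.+-mono-≤ j<n j<n) ⟩
        d ℕ.+ (n ℕ.+ n)                 ≤⟨ bound ⟩
        l ℕ.+ (j ℕ.+ j)                 ∎)

    abstract
      value-antipode : ∀ x y → Antipodes x y → ∀ i → value y i ≈ - value x i
      value-antipode x y y≈-x = newton-neg (coord x) (coord y) y≈-x

      contradictory-signs : ∀ s {v w} → w ≈ - v → 0# < signed s v → 0# < signed s w → ⊥
      contradictory-signs s {v} {w} w≈-v 0<v 0<w = <-irrefl (+-pos 0<v 0<w)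
        (≤-reflexive (trans (+-congˡ (trans (signed-cong s w≈-v) (signed-neg s v)))
            (-‿inverseʳ _)))

    Gale-antipodal : ∀ {M} (i : Fin M) → AntipodeFree (Gale-set i)
    Gale-antipodal i x y y≈-x (x∈ , y∈) =
      contradictory-signs (parity true (toℕ i)) (value-antipode x y y≈-x (toℕ i)) x∈ y∈

    abstract
      near-+ : ∀ {ε x y x′ y′} → Near (½ * ε) x′ x → Near (½ * ε) y′ y →
               Near ε (x′ + y′) (x + y)
      near-+ {ε} {x} {y} {x′} {y′} (p , q) (p′ , q′) = add x x′ y y′ p p′ , add x′ x y′ y q q′
        where
        add : ∀ x x′ y y′ → x′ - x ≤ ½ * ε → y′ - y ≤ ½ * ε → x′ + y′ - (x + y) ≤ ε
        add x x′ y y′ p p′ = ≤-respʳ-≈ (halves ε) (≤-respˡ-≈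
          (solve 4 (λ x x′ y y′ → (x′ :- x) :+ (y′ :- y) := x′ :+ y′ :-
              (x :+ y)) refl x x′ y y′)
          (+-mono-≤ p p′))

    newton-continuous : ∀ {k} (a : Vector Carrier k) i {η} → 0# < η → ∃ λ ε → 0# < ε ×
                        (∀ b → (∀ j → Near ε (b j) (a j)) → Near η (newton b i) (newton a i))
    newton-continuous {zero}  a i {η} 0<η = η , 0<η , λ b near → near-refl (<⇒≤ 0<η) refl
    newton-continuous {suc k} a zero {η} 0<η = η , 0<η , λ b near → near zero
    newton-continuous {suc k} a (suc i) {η} 0<η =
      let (ε , 0<ε , cont)    = newton-continuous a i (half-pos 0<η)
          (ε′ , 0<ε′ , cont′) = newton-continuous (tail a) i (half-pos 0<η)
      in ε ⊓ ε′ , ⊓-pos 0<ε 0<ε′ , λ b near →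
         near-+ (cont b (λ j → near-mono (x⊓y≤x ε ε′) (near j)))
                (cont′ (tail b) (λ j → near-mono (x⊓y≤y ε ε′) (near (suc j))))

    abstract
      near-signed : ∀ s {x y} → 0# < signed s x → Near (½ * signed s x) y x → 0# < signed s y
      near-signed true  {x} {y} 0<x (_ , x-y≤h) = <-≤-trans (half-pos 0<x)
        (≤-by (gap x-y≤h) (trans (+-congˡ (-‿cong (sym (half x)))) (identity (½ * x) x y)))
        where
        half : ∀ x → x - ½ * x ≈ ½ * x
        half x = trans (+-congʳ (sym (halves x)))
            (solve 1 (λ h → h :+ h :- h := h) refl (½ * x))
        identity : ∀ h x y → y - (x - h) ≈ h - (x - y)
        identity = solve 3 (λ h x y → y :- (x :- h) := h :- (x :- y)) refl
      near-signed false {x} {y} 0<-x (y-x≤h , _) = <-≤-trans (half-pos 0<-x)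
        (≤-by (gap y-x≤h) (trans (+-congˡ (-‿cong (sym (half (- x)))))
            (identity (½ * - x) x y)))
        where
        half : ∀ x → x - ½ * x ≈ ½ * x
        half x = trans (+-congʳ (sym (halves x)))
            (solve 1 (λ h → h :+ h :- h := h) refl (½ * x))
        identity : ∀ h x y → - y - (- x - h) ≈ h - (y - x)
        identity = solve 3 (λ h x y → :- y :- (:- x :- h) := h :- (y :- x)) refl

    Gale-open : ∀ {M} (i : Fin M) → IsOpen (Gale-set i)
    Gale-open i x x∈ =
      let s = parity true (toℕ i)
          (ε , 0<ε , cont) = newton-continuous (coord x) (toℕ i) (half-pos x∈)
      in ε , 0<ε , λ y close → near-signed s x∈
          (cont (coord y) (coordinate-near {x} {y} 0<ε close))

    upper-bound : ∀ n q → Guaranteed ℝ d n q → q ℕ.≤ d ℕ.+ n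
    upper-bound n q guaranteed =
      let M = d ℕ.+ (n ℕ.+ n)
          (x , I , q≤I , I⊆) = guaranteed M Gale-set (Gale-cover n , Gale-antipodal) Gale-open
          (J , n≤J , J⊆)     = Gale-cover n (negate x)
          disjoint : I ⊆ₛ ∁ J
          disjoint {i} i∈I = x∉p⇒x∈∁p (λ i∈J →
            Gale-antipodal i x (negate x) (λ _ → refl) (I⊆ i i∈I , J⊆ i i∈J))
      in begin
        q             ≤⟨ q≤I ⟩
        ∣ I ∣          ≤⟨ p⊆q⇒∣p∣≤∣q∣ disjoint ⟩
        ∣ ∁ J ∣        ≡⟨ ∣∁p∣≡n∸∣p∣ J ⟩
        M ℕ.∸ ∣ J ∣    ≤⟨ ℕ.∸-monoʳ-≤ M n≤J ⟩
        M ℕ.∸ n       ≡⟨ ≡.cong (ℕ._∸ n) (ℕ.+-assoc d n n) ⟨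
        d ℕ.+ n ℕ.+ n ℕ.∸ n ≡⟨ ℕ.m+n∸n≡m (d ℕ.+ n) n ⟩
        d ℕ.+ n       ∎
      where open ℕ.≤-Reasoning

-- The lower bound

least-element : (I : Subset m) → 1 ℕ.≤ ∣ I ∣ → ∃ λ i → i ∈ₛ I × (∀ {j} → j Fin.< i → j ∉ₛ I)
least-element (inside  ∷ I) 1≤∣I∣ = zero , here , λ ()
least-element (outside ∷ I) 1≤∣I∣ =
  let (i , i∈I , least) = least-element I 1≤∣I∣
  in suc i , there i∈I , λ { {suc j} (ℕ.s≤s j<i) (there j∈I) → least j<i j∈I }

insert : ∀ (I : Subset m) {j} → j ∉ₛ I →
         ∃ λ J → ∣ J ∣ ≡ suc ∣ I ∣ × (∀ i → i ∈ₛ J → i ≡ j ⊎ i ∈ₛ I)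
insert (inside  ∷ I) {zero}  j∉I = contradiction here j∉I
insert (outside ∷ I) {zero}  j∉I = inside ∷ I , ≡.refl ,
  λ { zero here → inj₁ ≡.refl ; (suc i) (there i∈I) → inj₂ (there i∈I) }
insert (s ∷ I) {suc j} j∉I =
  let (J , ∣J∣ , J⊆) = insert I (j∉I ∘ there)
  in s ∷ J , size s I J ∣J∣ , λ where
    zero    here        → inj₂ here
    (suc i) (there i∈J) → [ inj₁ ∘ ≡.cong suc , inj₂ ∘ there ]′ (J⊆ i i∈J)
  where
  size : ∀ s {k l} (I : Subset k) (J : Subset l) → ∣ J ∣ ≡ suc ∣ I ∣ → ∣ s ∷ J ∣ ≡ suc ∣ s ∷ I ∣
  size inside  I J eq = ≡.cong suc eq
  size outside I J eq = eq

drop-least : (I : Subset m) → suc n ℕ.≤ ∣ I ∣ →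
             ∃ λ J → n ℕ.≤ ∣ J ∣ × (∀ i → i ∈ₛ J → i ∈ₛ I × ∃ λ j → j Fin.< i × j ∈ₛ I)
drop-least (inside ∷ I) n<∣I∣ = outside ∷ I , ℕ.s≤s⁻¹ n<∣I∣ ,
  λ { (suc i) (there i∈I) → there i∈I , zero , ℕ.z<s , here }
drop-least (outside ∷ I) n<∣I∣ =
  let (J , n≤∣J∣ , J⊆) = drop-least I n<∣I∣
  in outside ∷ J , n≤∣J∣ , λ where
    (suc i) (there i∈J) →
      let (i∈I , j , j<i , j∈I) = J⊆ i i∈J in there i∈I , suc j , ℕ.s≤s j<i , there j∈I

∈⇒1≤∣p∣ : ∀ {p : Subset m} {i} → i ∈ₛ p → 1 ℕ.≤ ∣ p ∣
∈⇒1≤∣p∣ here = ℕ.s≤s ℕ.z≤n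
∈⇒1≤∣p∣ {p = inside  ∷ p} (there i∈p) = ℕ.s≤s ℕ.z≤n
∈⇒1≤∣p∣ {p = outside ∷ p} (there i∈p) = ∈⇒1≤∣p∣ i∈p

⊆-full : ∀ {p q : Subset m} → p ⊆ₛ q → ∣ q ∣ ℕ.≤ ∣ p ∣ → p ≡ q
⊆-full {p = []}          {[]}          p⊆q ∣q∣≤∣p∣ = ≡.refl
⊆-full {p = inside  ∷ p} {inside  ∷ q} p⊆q ∣q∣≤∣p∣ = ≡.cong (inside ∷_)
    (⊆-full (drop-∷-⊆ p⊆q) (ℕ.s≤s⁻¹ ∣q∣≤∣p∣))
⊆-full {p = inside  ∷ p} {outside ∷ q} p⊆q ∣q∣≤∣p∣ = contradiction (p⊆q here) λ ()
⊆-full {p = outside ∷ p} {inside  ∷ q} p⊆q ∣q∣≤∣p∣ = contradiction (p⊆q⇒∣p∣≤∣q∣ (drop-∷-⊆ p⊆q))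
    (ℕ.<⇒≱ ∣q∣≤∣p∣)
⊆-full {p = outside ∷ p} {outside ∷ q} p⊆q ∣q∣≤∣p∣ = ≡.cong (outside ∷_)
    (⊆-full (drop-∷-⊆ p⊆q) ∣q∣≤∣p∣)

-- The side that owns the first index at which `p` and `q` differ. For disjoint sets this is the
-- least element of the union, and the default `s` is returned only when both are empty.
leadingSign : Bool → Subset m → Subset m → Bool
leadingSign s []      []      = s
leadingSign s (a ∷ p) (b ∷ q) = if a xor b then a else leadingSign s p q

leadingSign-swap : ∀ s (p q : Subset m) → leadingSign (not s) q p ≡ not (leadingSign s p q)
leadingSign-swap s []          []          = ≡.refl
leadingSign-swap s (true  ∷ p) (true  ∷ q) = leadingSign-swap s p q
leadingSign-swap s (true  ∷ p) (false ∷ q) = ≡.refl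
leadingSign-swap s (false ∷ p) (true  ∷ q) = ≡.refl
leadingSign-swap s (false ∷ p) (false ∷ q) = leadingSign-swap s p q

leadingSign-unique : ∀ s t (p q : Subset m) {i} → i ∈ₛ p → i ∉ₛ q →
    leadingSign s p q ≡ leadingSign t p q
leadingSign-unique s t (true  ∷ p) (true  ∷ q) here        i∉q = contradiction here i∉q
leadingSign-unique s t (true  ∷ p) (false ∷ q) i∈p         i∉q = ≡.refl
leadingSign-unique s t (false ∷ p) (true  ∷ q) i∈p         i∉q = ≡.refl
leadingSign-unique s t (true  ∷ p) (true  ∷ q) (there i∈p) i∉q = leadingSign-unique s t p q i∈p
    (i∉q ∘ there)
leadingSign-unique s t (false ∷ p) (false ∷ q) (there i∈p) i∉q = leadingSign-unique s t p q i∈p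
    (i∉q ∘ there)

-- If the total size did not grow, both inclusions would be equalities. The element i of p outside q
-- makes the defaults irrelevant, so the signs would then agree.
leadingSign-strict : ∀ {s s′} {p q p′ q′ : Subset m} {i} → p ⊆ₛ p′ → q ⊆ₛ q′ → i ∈ₛ p → i ∉ₛ q →
                     leadingSign s p q ≡ not (leadingSign s′ p′ q′) →
                     ∣ p ∣ ℕ.+ ∣ q ∣ ℕ.< ∣ p′ ∣ ℕ.+ ∣ q′ ∣
leadingSign-strict {s = s} {s′} {p} {q} {p′} {q′} p⊆p′ q⊆q′ i∈p i∉q opposite = ℕ.≰⇒> λ small →
  let ∣p∣≤∣p′∣ = p⊆q⇒∣p∣≤∣q∣ p⊆p′
      ∣q∣≤∣q′∣ = p⊆q⇒∣p∣≤∣q∣ q⊆q′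
      p≡p′ = ⊆-full p⊆p′ (ℕ.+-cancelʳ-≤ (∣ q ∣) _ _
          (ℕ.≤-trans (ℕ.+-monoʳ-≤ ∣ p′ ∣ ∣q∣≤∣q′∣) small))
      q≡q′ = ⊆-full q⊆q′ (ℕ.+-cancelˡ-≤ (∣ p ∣) _ _
          (ℕ.≤-trans (ℕ.+-monoˡ-≤ ∣ q′ ∣ ∣p∣≤∣p′∣) small))
  in irreflexive _ (≡.trans (≡.sym opposite)
       (≡.trans (leadingSign-unique s s′ p q i∈p i∉q) (≡.cong₂ (leadingSign s′) p≡p′ q≡q′)))
  where
  irreflexive : ∀ b → ¬ (not b ≡ b)
  irreflexive true  ()
  irreflexive false ()

facet-⊆ : ∀ {V : Set} {σ : Vec V n} {τ v} → Facet σ τ → v ∈ σ → v ∈ τ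
facet-⊆ here      v∈σ                = Any.there v∈σ
facet-⊆ (there f) (Any.here v≡w)     = Any.here v≡w
facet-⊆ (there f) (Any.there v∈σ)    = Any.there (facet-⊆ f v∈σ)

-- Reduction to one-fold covers

module Induction (em : ExcludedMiddle 0ℓ) (ℝ : Reals) (d : ℕ) where
  open Reals ℝ hiding (zero)
  open OrderedField ℝ
  open Analysis em ℝ
  open UnitSphere ℝ d

  add-fold : ∀ n q → 1 ℕ.≤ q → Guaranteed ℝ d n q → Guaranteed ℝ d (suc n) (suc q)
  add-fold n q 1≤q guaranteed m U (cover , antipodal) open-U =
    let (x , I , q≤I , I⊆)    = guaranteed m Later (later-cover , later-antipodal) later-open
        (i , i∈I , least)     = least-element I (ℕ.≤-trans 1≤q q≤I)
        (_ , j , j<i , x∈Uj)  = I⊆ i i∈I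
        -- The index j witnesses that x lies in the `Later` set of i; being below the least element
        -- of `I`, it is a new index.
        (J , ∣J∣≡1+∣I∣ , J⊆)  = insert I (least j<i)
    in x , J , ≡.subst (suc q ℕ.≤_) (≡.sym ∣J∣≡1+∣I∣) (ℕ.s≤s q≤I) ,
       λ k k∈J → [ (λ k≡j → ≡.subst (λ k → U k x) (≡.sym k≡j) x∈Uj) ,
           (λ k∈I → proj₁ (I⊆ k k∈I)) ]′ (J⊆ k k∈J)
    where
    Later : Family m
    Later i x = U i x × ∃ λ j → j Fin.< i × U j x

    later-cover : IsFoldCover n Later
    later-cover x =
      let (I , n<I , I⊆) = cover x
          (J , n≤J , J⊆) = drop-least I n<I
      in J , n≤J , λ i i∈J →
         let (i∈I , j , j<i , j∈I) = J⊆ i i∈J in I⊆ i i∈I , j , j<i , I⊆ j j∈I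

    later-antipodal : ∀ i → AntipodeFree (Later i)
    later-antipodal i x y y≈-x (x∈ , y∈) = antipodal i x y y≈-x (proj₁ x∈ , proj₁ y∈)

    later-open : ∀ i → IsOpen (Later i)
    later-open i x (x∈Ui , j , j<i , x∈Uj) =
      let (ε , 0<ε , ball)    = open-U i x x∈Ui
          (ε′ , 0<ε′ , ball′) = open-U j x x∈Uj
          0≤ε⊓ε′ = <⇒≤ (⊓-pos 0<ε 0<ε′)
      in ε ⊓ ε′ , ⊓-pos 0<ε 0<ε′ , λ y close →
         ball y (<-≤-trans close (square-mono-≤ 0≤ε⊓ε′ (x⊓y≤x ε ε′))) , j , j<i ,
         ball′ y (<-≤-trans close (square-mono-≤ 0≤ε⊓ε′ (x⊓y≤y ε ε′)))

-- Subdividing the boundary of the cube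

module CubeSubdivision (em : ExcludedMiddle 0ℓ) (ℝ : Reals) where
  open Reals ℝ hiding (zero; _≉_)
  open OrderedField ℝ
  open Analysis em ℝ

  sign : Bool → Carrier
  sign true  = 1#
  sign false = - 1#

  -- The Boolean is a formal sign, so that an odd choice of sign exists even
  -- at the vertices where the cover determines none.
  Vertex : ℕ → Set
  Vertex k = Vector Carrier k × Bool

  Antipodal : Vertex k → Vertex k → Set
  Antipodal (v , s) (w , t) = (∀ c → w c ≈ - v c) × t ≡ not s

  maximum : {A : Set} → (A → Carrier) → Vec A (suc n) → Carrier
  maximum g (v ∷ [])      = g v
  maximum g (v ∷ τ@(_ ∷ _)) = g v ⊔ maximum g τ

  -- The centre of the bounding box of a simplex.
  centre : Vec (Vertex k) (suc n) → Vertex k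
  centre τ = (λ c → ½ * (maximum (λ v → proj₁ v c) τ - maximum (λ v → - proj₁ v c) τ)) ,
             proj₂ (Vec.head τ)

  -- The bounding box, described by the coordinate bounds common to all vertices. In this form it is
  -- defined for empty lists too, and it grows with the list at once.
  Hull : Vec (Vertex k) n → Vertex k → Set
  Hull τ (v , _) = ∀ c b → ((∀ {w} → w ∈ τ → proj₁ w c ≤ b) → v c ≤ b) ×
                           ((∀ {w} → w ∈ τ → b ≤ proj₁ w c) → b ≤ v c)

  Small : Carrier → Vec (Vertex k) n → Set
  Small D τ = ∀ {v w} → v ∈ τ → w ∈ τ → ∀ c → proj₁ v c - proj₁ w c ≤ D

  abstract
    maximum-upper : ∀ {A : Set} (g : A → Carrier) (τ : Vec A (suc n)) {v} → v ∈ τ →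
        g v ≤ maximum g τ
    maximum-upper g (v ∷ [])      (Any.here ≡.refl) = ≤-refl
    maximum-upper g (v ∷ w ∷ τ)   (Any.here ≡.refl) = x≤x⊔y _ _
    maximum-upper g (v ∷ w ∷ τ)   (Any.there u∈)    = ≤-trans (maximum-upper g (w ∷ τ) u∈)
        (x≤y⊔x _ _)

    maximum-least : ∀ {A : Set} (g : A → Carrier) (τ : Vec A (suc n)) {b} →
        (∀ {v} → v ∈ τ → g v ≤ b) → maximum g τ ≤ b
    maximum-least g (v ∷ [])    bound = bound (Any.here ≡.refl)
    maximum-least g (v ∷ w ∷ τ) bound = ⊔-lub (bound (Any.here ≡.refl))
        (maximum-least g (w ∷ τ) (λ u∈ → bound (Any.there u∈)))

    maximum-cong : ∀ {A : Set} {R : A → A → Set} {g h : A → Carrier} →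
        (∀ {v w} → R v w → g v ≈ h w) →
                   ∀ {τ τ′ : Vec A (suc n)} → Pointwise R τ τ′ → maximum g τ ≈ maximum h τ′
    maximum-cong eq (r ∷ [])           = eq r
    maximum-cong eq (r ∷ rs@(_ ∷ _)) = ⊔-cong (eq r) (maximum-cong eq rs)

    centre-antipodal : ∀ {τ τ′ : Vec (Vertex k) (suc n)} → Pointwise Antipodal τ τ′ →
                       Antipodal (centre τ) (centre τ′)
    centre-antipodal {τ = τ} {τ′} rs = (λ c → trans
      (*-congˡ (+-cong (sym (maximum-cong (λ (r , _) → sym (r c)) rs))
        (-‿cong (sym (maximum-cong (λ (r , _) → trans (solve 1 (λ x → x := :- :- x) refl _)
            (-‿cong (sym (r c)))) rs)))))
      (flip-difference ½ (maximum (λ v → proj₁ v c) τ) (maximum (λ v → - proj₁ v c) τ))) ,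
          heads rs
      where
      flip-difference : ∀ h a b → h * (b - a) ≈ - (h * (a - b))
      flip-difference = solve 3 (λ h a b → h :* (b :- a) := :- (h :* (a :- b))) refl
      heads : ∀ {k n} {τ τ′ : Vec (Vertex k) (suc n)} → Pointwise Antipodal τ τ′ →
              proj₂ (Vec.head τ′) ≡ not (proj₂ (Vec.head τ))
      heads ((_ , s) ∷ _) = s

    half-mono : ∀ {x y} → x ≤ y → ½ * x ≤ ½ * y
    half-mono {x} {y} x≤y = ≤-by (*-nonNeg (<⇒≤ 0<½) (gap x≤y))
        (solve 3 (λ h x y → h :* y :- h :* x := h :* (y :- x)) refl ½ x y)

    middle-upper : ∀ {a b c} → a ≤ c → - b ≤ c → ½ * (a - b) ≤ c
    middle-upper {a} {b} {c} a≤c -b≤c = ≤-respʳ-≈ (trans (distribˡ ½ c c) (halves c))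
        (half-mono (+-mono-≤ a≤c -b≤c))

    middle-lower : ∀ {a b c} → c ≤ a → c ≤ - b → c ≤ ½ * (a - b)
    middle-lower {a} {b} {c} c≤a c≤-b = ≤-respˡ-≈ (trans (distribˡ ½ c c) (halves c))
        (half-mono (+-mono-≤ c≤a c≤-b))

    negate-≤ : ∀ {x y} → - x ≤ y → - y ≤ x
    negate-≤ {x} {y} -x≤y = ≤-by (gap -x≤y) (solve 2 (λ x y → x :- :- y := y :- :- x) refl x y)

    ≤-negate : ∀ {x y} → x ≤ - y → y ≤ - x
    ≤-negate {x} {y} x≤-y = ≤-by (gap x≤-y) (solve 2 (λ x y → :- x :- y := :- y :- x) refl x y)

    centre-hull : ∀ (τ : Vec (Vertex k) (suc n)) → Hull τ (centre τ)
    centre-hull τ@(v ∷ _) c b =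
      (λ below → middle-upper (maximum-least _ τ below)
        (negate-≤ (≤-trans (neg-mono-≤ (below (Any.here ≡.refl)))
            (maximum-upper _ τ (Any.here ≡.refl))))) ,
      (λ above → middle-lower (≤-trans (above (Any.here ≡.refl))
          (maximum-upper _ τ (Any.here ≡.refl)))
        (≤-negate (maximum-least _ τ (λ w∈ → neg-mono-≤ (above w∈)))))

    -- In coordinate c the bounding box is the interval from -b to a, of width a + b ≤ D, and the
    -- centre is its midpoint.
    centre-close : ∀ {D} (τ : Vec (Vertex k) (suc n)) → Small D τ → ∀ {v} → Hull τ v → ∀ c →
                   proj₁ (centre τ) c - proj₁ v c ≤ ½ * D ×
                   proj₁ v c - proj₁ (centre τ) c ≤ ½ * D
    centre-close {D = D} τ small {v , _} hull c =
      ≤-trans (≤-trans (+-mono-≤ (≤-refl {½ * (a - b)}) (negate-≤ -b≤v))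
          (≤-reflexive (to-left a b))) (half-mono width) ,
      ≤-trans (≤-trans (+-mono-≤ v≤a ≤-refl) (≤-reflexive (to-right a b))) (half-mono width)
      where
      a b : Carrier
      a = maximum (λ v → proj₁ v c) τ
      b = maximum (λ v → - proj₁ v c) τ
      v≤a : v c ≤ a
      v≤a = proj₁ (hull c a) (maximum-upper _ τ)
      -b≤v : - b ≤ v c
      -b≤v = proj₂ (hull c (- b)) (λ w∈ → negate-≤ (maximum-upper _ τ w∈))
      width : a + b ≤ D
      width = ≤-by (gap {a} {D - b} (maximum-least _ τ (λ {u} u∈ →
                  flip-b (maximum-least _ τ (λ {w} w∈ → bound (proj₁ u c) (proj₁ w c)
                      (small u∈ w∈ c))))))
                (solve 3 (λ a b D → D :- (a :+ b) := D :- b :- a) refl a b D)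
        where
        bound : ∀ u w → u - w ≤ D → - w ≤ D - u
        bound u w p = ≤-by (gap p) (solve 3
            (λ u w D → D :- u :- :- w := D :- (u :- w)) refl u w D)
        flip-b : ∀ {u} → b ≤ D - u → u ≤ D - b
        flip-b {u} p = ≤-by (gap p) (solve 3 (λ u b D → D :- b :- u := D :- u :- b) refl u b D)
      to-left : ∀ a b → ½ * (a - b) + b ≈ ½ * (a + b)
      to-left a b = trans (+-congˡ (sym (halves b)))
          (solve 3 (λ h a b → h :* (a :- b) :+ (h :* b :+ h :* b) := h :* (a :+ b)) refl ½ a b)
      to-right : ∀ a b → a - ½ * (a - b) ≈ ½ * (a + b)
      to-right a b = trans (+-congʳ (sym (halves a)))
          (solve 3 (λ h a b → h :* a :+ h :* a :- h :* (a :- b) := h :* (a :+ b)) refl ½ a b)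

  hull-⊆ : ∀ {σ : Vec (Vertex k) m} {τ : Vec (Vertex k) n} → (∀ {v} → v ∈ σ → v ∈ τ) → ∀ {v} →
      Hull σ v → Hull τ v
  hull-⊆ σ⊆τ hull c b = (λ below → proj₁ (hull c b) (λ w∈ → below (σ⊆τ w∈))) ,
      (λ above → proj₂ (hull c b) (λ w∈ → above (σ⊆τ w∈)))

  module Centres {k : ℕ} = Subdivision {Vertex k} {Vertex k} centre
  open Centres using (Flag; []; _∷_)

  flag-hull : ∀ {τ ρ : Vec (Vertex k) n} → Flag τ ρ → ∀ {v} → v ∈ ρ → Hull τ v
  flag-hull {τ = τ} (f ∷ fl) (Any.here ≡.refl) = centre-hull τ
  flag-hull {τ = τ} (_∷_ {σ = σ} f fl) {v} (Any.there v∈) = hull-⊆ (facet-⊆ f) {v}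
      (flag-hull fl v∈)

  -- The apex is the centre of the box of τ, and all other vertices lie in that box, hence within
  -- half the width. Pairs that avoid the apex belong to a flag of a facet of τ.
  flag-small : ∀ {D} {τ ρ : Vec (Vertex k) n} → Small D τ → Flag τ ρ → Small (½ * D) ρ
  flag-small {τ = τ} small (f ∷ fl) {v} {w} (Any.here ≡.refl) w∈ c =
    proj₁ (centre-close τ small {w} (flag-hull {τ = τ} (f ∷ fl) w∈) c)
  flag-small {τ = τ} small (f ∷ fl) {v} {w} v∈@(Any.there _) (Any.here ≡.refl) c =
    proj₂ (centre-close τ small {v} (flag-hull {τ = τ} (f ∷ fl) v∈) c)
  flag-small small (f ∷ fl) (Any.there v∈) (Any.there w∈) c =
    flag-small (λ u∈ u′∈ → small (facet-⊆ f u∈) (facet-⊆ f u′∈)) fl v∈ w∈ c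

  -- A facet of the cube [-1, 1]^k, given by a coordinate and a sign.
  Face : ℕ → Set
  Face k = Fin k × Bool

  pin : ∀ {c j : Fin k} → Dec (c ≡ j) → Carrier → Carrier → Carrier
  pin (yes _) x y = x
  pin (no  _) x y = y

  -- Both bounds coincide in the pinned coordinate, so a facet is a degenerate box and `box-compact`
  -- applies to it as it stands.
  lower upper : Face k → Vector Carrier k
  lower (j , s) c = pin (c Fin.≟ j) (sign s) (- 1#)
  upper (j , s) c = pin (c Fin.≟ j) (sign s) 1#

  OnFace : Face k → Vector Carrier k → Set
  OnFace f = InBox (lower f) (upper f)

  opposite : Face k → Face k
  opposite (j , s) = j , not s

  abstract
    sign-not : ∀ s → sign (not s) ≈ - sign s
    sign-not true  = refl
    sign-not false = solve 0 (:1 := :- :- :1) refl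

    -1≤1 : - 1# ≤ 1#
    -1≤1 = ≤-by (+-nonNeg (<⇒≤ 0<1) (<⇒≤ 0<1)) (solve 0 (:1 :- :- :1 := :1 :+ :1) refl)

    sign-bounds : ∀ s → - 1# ≤ sign s × sign s ≤ 1#
    sign-bounds true  = -1≤1 , ≤-refl
    sign-bounds false = ≤-refl , -1≤1

    lower≤upper : ∀ (f : Face k) c → lower f c ≤ upper f c
    lower≤upper (j , s) c = go (c Fin.≟ j)
      where
      go : (dec : Dec (c ≡ j)) → pin dec (sign s) (- 1#) ≤ pin dec (sign s) 1#
      go (yes _) = ≤-refl
      go (no  _) = -1≤1

    onFace-bounds : ∀ (f : Face k) {v} → OnFace f v → ∀ c → - 1# ≤ v c × v c ≤ 1#
    onFace-bounds (j , s) {v} v∈ c = go (c Fin.≟ j) (v∈ c)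
      where
      go : (dec : Dec (c ≡ j)) → pin dec (sign s) (- 1#) ≤ v c × v c ≤ pin dec (sign s) 1# →
          - 1# ≤ v c × v c ≤ 1#
      go (yes _) (l , u) = ≤-trans (proj₁ (sign-bounds s)) l , ≤-trans u (proj₂ (sign-bounds s))
      go (no  _) bounds  = bounds

    onFace-pinned : ∀ (f : Face k) {v} → OnFace f v → v (proj₁ f) ≈ sign (proj₂ f)
    onFace-pinned (j , s) {v} v∈ = go (j Fin.≟ j) (v∈ j)
      where
      go : (dec : Dec (j ≡ j)) → pin dec (sign s) (- 1#) ≤ v j × v j ≤ pin dec (sign s) 1# →
          v j ≈ sign s
      go (yes _)  (l , u) = ≤-antisym u l
      go (no j≢j) _       = contradiction ≡.refl j≢j

    pinned-onFace : ∀ (f : Face k) {v} → v (proj₁ f) ≈ sign (proj₂ f) →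
        (∀ c → - 1# ≤ v c × v c ≤ 1#) → OnFace f v
    pinned-onFace (j , s) {v} vj≈s bounds c = go (c Fin.≟ j)
      where
      go : (dec : Dec (c ≡ j)) → pin dec (sign s) (- 1#) ≤ v c × v c ≤ pin dec (sign s) 1#
      go (yes ≡.refl) = ≤-reflexive (sym vj≈s) , ≤-reflexive vj≈s
      go (no  _)      = bounds c

    onFace-opposite : ∀ (f : Face k) {v} → OnFace f v → OnFace (opposite f) (λ c → - v c)
    onFace-opposite f@(j , s) {v} v∈ = pinned-onFace (opposite f)
      (trans (-‿cong (onFace-pinned f v∈)) (sym (sign-not s)))
      (λ c → let (l , u) = onFace-bounds f v∈ c in neg-mono-≤ u , negate-≤ l)

    sign² : ∀ s → sign s * sign s ≈ 1#
    sign² true  = *-identityʳ 1#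
    sign² false = solve 0 (:- :1 :* :- :1 := :1) refl

  SimplexOnFace : Face k → Vec (Vertex k) n → Set
  SimplexOnFace f τ = ∀ {v} → v ∈ τ → OnFace f (proj₁ v)

  flag-onFace : ∀ (f : Face k) {τ ρ : Vec (Vertex k) n} → SimplexOnFace f τ → Flag τ ρ →
                SimplexOnFace f ρ
  flag-onFace f onFace flag v∈ c =
    let hull = flag-hull flag v∈ c
    in proj₂ (hull (lower f c)) (λ w∈ → proj₁ (onFace w∈ c)) , proj₁ (hull (upper f c))
        (λ w∈ → proj₂ (onFace w∈ c))

  -- The face with vertices τ of the cross-polytope is sent to the centre of
  -- the dual face of the cube.
  dualCentre : Vec (Face k) n → Vector Carrier k
  dualCentre []            c = 0#
  dualCentre ((j , s) ∷ τ) c = pin (c Fin.≟ j) (sign s) (dualCentre τ c)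

  dualVertex : Vec (Face k) (suc n) → Vertex k
  dualVertex τ = dualCentre τ , proj₂ (Vec.head τ)

  Consistent : Vec (Face k) n → Set
  Consistent τ = ∀ {j s t} → (j , s) ∈ τ → (j , t) ∈ τ → s ≡ t

  Opposite : Face k → Face k → Set
  Opposite f g = g ≡ opposite f

  abstract
    dualVertex-antipodal : ∀ {τ τ′ : Vec (Face k) (suc n)} → Pointwise Opposite τ τ′ →
                           Antipodal (dualVertex τ) (dualVertex τ′)
    dualVertex-antipodal rs = centres rs , heads rs
      where
      centres : ∀ {k n} {τ τ′ : Vec (Face k) n} → Pointwise Opposite τ τ′ → ∀ c →
          dualCentre τ′ c ≈ - dualCentre τ c
      centres []                                c = solve 0 (:0 := :- :0) refl
      centres (_∷_ {x = j , s} ≡.refl rs) c = go (c Fin.≟ j) (centres rs c)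
        where
        go : ∀ (dec : Dec (c ≡ j)) {x y} → x ≈ - y →
             pin dec (sign (not s)) x ≈ - pin dec (sign s) y
        go (yes _) _  = sign-not s
        go (no  _) eq = eq
      heads : ∀ {k n} {τ τ′ : Vec (Face k) (suc n)} → Pointwise Opposite τ τ′ →
              proj₂ (Vec.head τ′) ≡ not (proj₂ (Vec.head τ))
      heads (≡.refl ∷ _) = ≡.refl

    dualCentre-bounds : ∀ (τ : Vec (Face k) n) c → - 1# ≤ dualCentre τ c × dualCentre τ c ≤ 1#
    dualCentre-bounds []            c = ≤-trans (neg-mono-≤ (<⇒≤ 0<1))
        (≤-reflexive (solve 0 (:- :0 := :0) refl)) , <⇒≤ 0<1
    dualCentre-bounds ((j , s) ∷ τ) c = go (c Fin.≟ j) (dualCentre-bounds τ c)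
      where
      go : ∀ (dec : Dec (c ≡ j)) {x} → - 1# ≤ x × x ≤ 1# →
           - 1# ≤ pin dec (sign s) x × pin dec (sign s) x ≤ 1#
      go (yes _) _      = sign-bounds s
      go (no  _) bounds = bounds

    dualCentre-pinned : ∀ (τ : Vec (Face k) n) → Consistent τ → ∀ {j s} → (j , s) ∈ τ →
        dualCentre τ j ≈ sign s
    dualCentre-pinned ((i , t) ∷ τ) consistent {j} {s} f∈ = go (j Fin.≟ i) f∈
      where
      go : ∀ (dec : Dec (j ≡ i)) → (j , s) ∈ ((i , t) ∷ τ) →
           pin dec (sign t) (dualCentre τ j) ≈ sign s
      go (yes ≡.refl) f∈                = reflexive
          (≡.cong sign (consistent (Any.here ≡.refl) f∈))
      go (no j≢i)     (Any.here ≡.refl) = contradiction ≡.refl j≢i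
      go (no j≢i)     (Any.there f∈)    = dualCentre-pinned τ
          (λ p q → consistent (Any.there p) (Any.there q)) f∈

  module Dual {k : ℕ} = Subdivision {Face k} {Vertex k} dualVertex

  -- A flag ends in a single vertex f of the cross-polytope, which belongs to every face of the
  -- flag. Consistency makes each dual centre carry the sign of f in its coordinate, so all of them
  -- lie on the facet f of the cube.
  dual-onFace : ∀ {τ : Vec (Face k) (suc n)} {ρ} → Consistent τ → Dual.Flag τ ρ →
                ∃ λ f → f ∈ τ × SimplexOnFace f ρ
  dual-onFace {n = zero} {τ = f ∷ []} consistent (_ Dual.∷ Dual.[]) =
    f , Any.here ≡.refl , λ { (Any.here ≡.refl) →
      pinned-onFace f (dualCentre-pinned (f ∷ []) consistent (Any.here ≡.refl))
          (dualCentre-bounds (f ∷ [])) }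
  dual-onFace {n = suc n} {τ = τ} consistent (σ⊂τ Dual.∷ flag) =
    let (f , f∈σ , onFace) = dual-onFace
            (λ p q → consistent (facet-⊆ σ⊂τ p) (facet-⊆ σ⊂τ q)) flag
        f∈τ = facet-⊆ σ⊂τ f∈σ
    in f , f∈τ , λ where
      (Any.here ≡.refl) → pinned-onFace f (dualCentre-pinned τ consistent f∈τ)
          (dualCentre-bounds τ)
      (Any.there v∈)    → onFace v∈

  onFace-small : ∀ (f : Face k) {ρ : Vec (Vertex k) n} → SimplexOnFace f ρ → Small (1# + 1#) ρ
  onFace-small f onFace {v} {w} v∈ w∈ c = +-mono-≤ (proj₂ (onFace-bounds f (onFace v∈) c))
    (negate-≤ (proj₁ (onFace-bounds f (onFace w∈) c)))

pointwise-right : ∀ {A B : Set} {R : A → B → Set} {xs : Vec A m} {ys : Vec B n} →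
                  Pointwise R xs ys →
                  ∀ {y} → y ∈ ys → ∃ λ x → x ∈ xs × R x y
pointwise-right (r ∷ rs) (Any.here ≡.refl) = _ , Any.here ≡.refl , r
pointwise-right (r ∷ rs) (Any.there y∈)    =
  let (x , x∈ , r) = pointwise-right rs y∈ in x , Any.there x∈ , r

pointwise-left : ∀ {A B : Set} {R : A → B → Set} {xs : Vec A m} {ys : Vec B n} →
                 Pointwise R xs ys →
                 ∀ {x} → x ∈ xs → ∃ λ y → y ∈ ys × R x y
pointwise-left (r ∷ rs) (Any.here ≡.refl) = _ , Any.here ≡.refl , r
pointwise-left (r ∷ rs) (Any.there x∈)    =
  let (y , y∈ , r) = pointwise-left rs x∈ in y , Any.there y∈ , r

alternating-uncons : ∀ s t (τ : Vec Bool n) → alternating s (t ∷ τ) ≡ true →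
                     t ≡ s × alternating (not s) τ ≡ true
alternating-uncons true  true  τ eq = ≡.refl , eq
alternating-uncons false false τ eq = ≡.refl , eq
alternating-uncons true  false τ ()
alternating-uncons false true  τ ()

-- By definition `⌈ n /2⌉` is the floor of half of `suc n`.
2*⌈n/2⌉≤1+n : ∀ n → ⌈ n /2⌉ ℕ.+ ⌈ n /2⌉ ℕ.≤ suc n
2*⌈n/2⌉≤1+n n = ℕ.≤-trans (ℕ.+-monoʳ-≤ ⌈ n /2⌉ (ℕ.⌊n/2⌋≤⌈n/2⌉ (suc n)))
                          (ℕ.≤-reflexive (ℕ.⌊n/2⌋+⌈n/2⌉≡n (suc n)))

-- One-fold covers and the contradiction with Ky Fan's lemma

module LowerBound (em : ExcludedMiddle 0ℓ) (ℝ : Reals) (d : ℕ) where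
  open Reals ℝ hiding (zero; _≉_)
  open OrderedField ℝ
  open Analysis em ℝ
  open UnitSphere ℝ d
  open SphereGeometry em ℝ d
  open CubeSubdivision em ℝ

  Point : Set
  Point = Vertex (suc d)

  Simplex : Set
  Simplex = ∃ λ n → Vec Point (suc n)

  listing : Vec Point (suc n) → Simplex
  listing τ = _ , τ

  AntipodalSimplex : Simplex → Simplex → Set
  AntipodalSimplex (_ , σ) (_ , τ) = Pointwise Antipodal σ τ

  minus : Point → Vector Carrier (suc d)
  minus (v , _) c = - v c

  face-norm : ∀ (f : Face (suc d)) {v} → OnFace f v → 1# ≤ ‖ v ‖²
  face-norm f {v} v∈ = ≤-respˡ-≈
    (trans (*-cong (onFace-pinned f v∈) (onFace-pinned f v∈)) (sign² (proj₂ f)))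
    (square≤norm v (proj₁ f))

  axes : ∀ k → Vec (Face k) k
  axes k = tabulate (λ j → j , true)

  opposite-involutive : ∀ (f : Face k) → opposite (opposite f) ≡ f
  opposite-involutive (j , s) = ≡.cong (j ,_) (not-involutive s)

  module Polytope {k : ℕ} = CrossPolytope {Face k} opposite opposite-involutive

  -- Place j of a transversal lies on axis j, so an entry is determined by its coordinate.
  transversal-consistent : ∀ {τ : Vec (Face k) k} → Polytope.Transversal (axes k) τ →
      Consistent τ
  transversal-consistent {k} {τ} t p q = ≡.cong proj₂ (≡.trans (at p) (≡.sym (at q)))
    where
    index : ∀ {n} {ws τ : Vec (Face k) n} → Polytope.Transversal ws τ →
            ∀ i → proj₁ (lookup τ i) ≡ proj₁ (lookup ws i)
    index (Polytope.keep t) zero    = ≡.refl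
    index (Polytope.keep t) (suc i) = index t i
    index (Polytope.flip t) zero    = ≡.refl
    index (Polytope.flip t) (suc i) = index t i
    at : ∀ {j s} → (j , s) ∈ τ → (j , s) ≡ lookup τ j
    at {j} {s} f∈ = ≡.trans (Any.lookup-index f∈)
        (≡.cong (lookup τ) (≡.sym (≡.trans (≡.cong proj₁ (Any.lookup-index f∈))
      (≡.trans (index t (Any.index f∈))
          (≡.cong proj₁ (Vec.lookup∘tabulate (λ j → j , true) (Any.index f∈)))))))

  module _ {m : ℕ} (U : Family m) (cover : IsFoldCover 1 U)
           (antipodal : ∀ i → AntipodeFree (U i)) (open-U : ∀ i → IsOpen (U i)) where

    -- Existential, since a `Point` may be any vector, while a projection exists only where the norm
    -- is at least 1; elsewhere nothing is hit.
    Hits : Fin m → Vector Carrier (suc d) → Set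
    Hits i v = ∃ λ x → v projectsTo x × U i x

    hits-cong : ∀ {i v w} → (∀ c → v c ≈ w c) → Hits i v → Hits i w
    hits-cong v≈w (x , (c , 1≤c , v≈cx) , x∈) = x ,
        (c , 1≤c , λ j → trans (sym (v≈w j)) (v≈cx j)) , x∈

    -- Two projections of one vector are at distance zero by `projection-contracts`, and an open set
    -- contains with a point all points at distance zero from it.
    hits-projection : ∀ {i v y} → Hits i v → v projectsTo y → U i y
    hits-projection {i} {v} {y} (x , v↦x , x∈) v↦y =
      let (ε , 0<ε , ball) = open-U i x x∈
      in ball y (≤-<-trans (projection-contracts {v} {v} {x} {y} v↦x v↦y)
           (≤-<-trans (≤-reflexive (norm-zero (λ j → v j - v j) (λ j → -‿inverseʳ (v j))))
               (*-pos 0<ε 0<ε)))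

    hits-antipode : ∀ {i v} → Hits i v → ¬ Hits i (λ c → - v c)
    hits-antipode {i} {v} hit (y , (c , 1≤c , -v≈cy) , y∈) = antipodal i y (negate y)
        (λ _ → refl)
      (y∈ , hits-projection hit (c , 1≤c , λ j → trans (solve 1 (λ v → v := :- :- v) refl (v j))
        (trans (-‿cong (-v≈cy j)) (solve 2 (λ c y → :- (c :* y) := c :* :- y) refl c
            (coord y j)))))

    -- δ is a Lebesgue number on the facet: each δ-neighbourhood, taken within the facet, is hit by
    -- a single set.
    Lebesgue : Face (suc d) → Carrier → Set
    Lebesgue f δ = ∀ q → OnFace f q → ∃ λ i → ∀ w → OnFace f w → (∀ c → Near δ (w c) (q c)) →
        Hits i w

    lebesgue-face : ∀ f → ∃ λ δ → 0# < δ × Lebesgue f δ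
    lebesgue-face f = box-compact (lower f) (upper f) (lower≤upper f) _
      (λ ε′≤ε (i , hits) → i , λ w w∈ near → hits w w∈ (λ c → near-mono ε′≤ε (near c))) local
      where
      within : ∀ {η p q w} → Near (½ * η) q p → Near (½ * η) w q → - η ≤ p - w × p - w ≤ η
      within {η} {p} {q} {w} (q-p , p-q) (w-q , q-w) =
        negate-≤ (≤-respˡ-≈ (solve 3 (λ p q w → (q :- p) :+ (w :- q) := :- (p :- w)) refl p q w)
            (≤-respʳ-≈ (halves η) (+-mono-≤ q-p w-q))) ,
        ≤-respˡ-≈ (solve 3 (λ p q w → (p :- q) :+ (q :- w) := p :- w) refl p q w)
            (≤-respʳ-≈ (halves η) (+-mono-≤ p-q q-w))
      local : ∀ p → OnFace f p → ∃ λ ε → 0# < ε ×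
          (∀ q → OnFace f q → (∀ c → Near ε (q c) (p c)) →
              ∃ λ i → ∀ w → OnFace f w → (∀ c → Near ε (w c) (q c)) → Hits i w)
      local p p∈ =
        let (x , p↦x)        = project p (face-norm f p∈)
            (I , 1≤∣I∣ , I⊆)  = cover x
            (i , i∈I , _)    = least-element I 1≤∣I∣
            (ε , 0<ε , ball) = open-U i x (I⊆ i i∈I)
            (η , 0<η , small) = small-norm (suc d) 0<ε
        -- Half of η, because w is reached from p by way of q.
        in ½ * η , half-pos 0<η , λ q _ q-near → i , λ w w∈ w-near →
           let (y , w↦y) = project w (face-norm f w∈)
           in y , w↦y , ball y (≤-<-trans (projection-contracts {p} {w} {x} {y} p↦x w↦y)
                (small (λ c → p c - w c) (λ c → within (q-near c) (w-near c))))

    lebesgue : ∃ λ δ → 0# < δ × (∀ f → Lebesgue f δ)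
    lebesgue =
      let (δ , 0<δ , both) = uniform (λ j ε → Lebesgue (j , true) ε × Lebesgue (j , false) ε)
            (λ {j} ε′≤ε (l , l′) → anti (j , true) ε′≤ε l , anti (j , false) ε′≤ε l′)
            (λ j → let (ε , 0<ε , l)    = lebesgue-face (j , true)
                       (ε′ , 0<ε′ , l′) = lebesgue-face (j , false)
                   in ε ⊓ ε′ , ⊓-pos 0<ε 0<ε′ ,
                      anti (j , true) (x⊓y≤x ε ε′) l , anti (j , false) (x⊓y≤y ε ε′) l′)
      in δ , 0<δ , λ { (j , true) → proj₁ (both j) ; (j , false) → proj₂ (both j) }
      where
      anti : ∀ f {ε ε′} → ε′ ≤ ε → Lebesgue f ε → Lebesgue f ε′
      anti f ε′≤ε l q q∈ = let (i , hits) = l q q∈ in i , λ w w∈ near → hits w w∈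
          (λ c → near-mono ε′≤ε (near c))

    -- The set P(σ) for g = `proj₁` and P(-σ) for g = `minus`.
    hitSet : (Point → Vector Carrier (suc d)) → Vec Point n → Subset m
    hitSet g τ = tabulate (λ i → does (em {∀ {v} → v ∈ τ → Hits i (g v)}))

    hitSet-sound : ∀ g (τ : Vec Point n) {i} → i ∈ₛ hitSet g τ → ∀ {v} → v ∈ τ → Hits i (g v)
    hitSet-sound g τ {i} i∈ = go em
        (≡.trans (≡.sym (Vec.lookup∘tabulate _ i)) (Vec.[]=⇒lookup i∈))
      where
      go : ∀ {P : Set} (dec : Dec P) → does dec ≡ true → P
      go (yes p) _ = p

    hitSet-complete : ∀ g (τ : Vec Point n) {i} → (∀ {v} → v ∈ τ → Hits i (g v)) →
        i ∈ₛ hitSet g τ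
    hitSet-complete g τ {i} hits = Vec.lookup⇒[]= i _
        (≡.trans (Vec.lookup∘tabulate _ i) (dec-true em hits))

    hitSet-antitone : ∀ g {σ : Vec Point n} {τ : Vec Point k} → (∀ {v} → v ∈ σ → v ∈ τ) →
        hitSet g τ ⊆ₛ hitSet g σ
    hitSet-antitone g {σ} {τ} σ⊆τ i∈ = hitSet-complete g σ (λ v∈ → hitSet-sound g τ i∈ (σ⊆τ v∈))

    hitSet-related : ∀ g h {τ : Vec Point n} {τ′ : Vec Point k} →
        (∀ {v w} → Antipodal v w → ∀ c → g v c ≈ h w c) →
                     Pointwise Antipodal τ τ′ → hitSet g τ ≡ hitSet h τ′
    hitSet-related g h eq rs = Vec.tabulate-cong λ i → does-⇔ (mk⇔
      (λ hits {w} w∈ → let (v , v∈ , r) = pointwise-right rs w∈ in hits-cong (eq r) (hits v∈))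
      (λ hits {v} v∈ → let (w , w∈ , r) = pointwise-left rs v∈ in hits-cong (λ c → sym (eq r c))
          (hits w∈))) em em

    -- Oddness is demanded of all tuples, including large ones for which both hit sets are empty;
    -- there the formal sign of the first vertex decides.
    simplexSign : Simplex → Bool
    simplexSign (_ , τ) = leadingSign (proj₂ (Vec.head τ)) (hitSet proj₁ τ) (hitSet minus τ)

    simplexSign-odd : ∀ {x y} → AntipodalSimplex x y → simplexSign y ≡ not (simplexSign x)
    simplexSign-odd {_ , (v , s) ∷ τ} {_ , (w , t) ∷ τ′} rs@((_ , ≡.refl) ∷ _) =
      ≡.trans (≡.cong₂ (leadingSign (not s))
          (≡.sym (hitSet-related minus proj₁ (λ (r , _) c → sym (r c)) rs))
                (≡.sym (hitSet-related proj₁ minus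
                    (λ (r , _) c → trans (solve 1 (λ x → x := :- :- x) refl _)
                    (-‿cong (sym (r c)))) rs)))
        (leadingSign-swap s (hitSet proj₁ ((v , s) ∷ τ)) (hitSet minus ((v , s) ∷ τ)))

    open FanPair

    -- A simplex undergoes r rounds of `centre` and one last round whose vertices are the simplices
    -- themselves; these carry the signs.
    fans : ℕ → FanPair Point Antipodal
    fans zero    = subdivide listing (λ rs → rs) (signPair simplexSign simplexSign-odd)
    fans (suc r) = subdivide centre centre-antipodal (fans r)

    module Listing = Subdivision {Point} {Simplex} listing

    module _ (δ : Carrier) (0<δ : 0# < δ) (leb : ∀ f → Lebesgue f δ)
             (few : ∀ x (I : Subset m) → (∀ i → i ∈ₛ I → U i x) → ∣ I ∣ ℕ.≤ ⌈ d /2⌉) where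

      rank : Vec Point n → ℕ
      rank τ = ∣ hitSet proj₁ τ ∣ ℕ.+ ∣ hitSet minus τ ∣

      hitSet-few : ∀ f g {v} (τ : Vec Point (suc n)) → v ∈ τ → OnFace f (g v) →
          ∣ hitSet g τ ∣ ℕ.≤ ⌈ d /2⌉
      hitSet-few f g {v} τ v∈ onFace =
        let (y , v↦y) = project (g v) (face-norm f onFace)
        in few y (hitSet g τ) (λ i i∈ → hits-projection (hitSet-sound g τ i∈ v∈) v↦y)

      module _ (f : Face (suc d)) where
        rank-few : (τ : Vec Point (suc n)) → SimplexOnFace f τ → rank τ ℕ.≤ ⌈ d /2⌉ ℕ.+ ⌈ d /2⌉
        rank-few τ@(v ∷ _) onFace = ℕ.+-mono-≤
          (hitSet-few f proj₁ {v} τ (Any.here ≡.refl) (onFace (Any.here ≡.refl)))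
          (hitSet-few (opposite f) minus {v} τ (Any.here ≡.refl)
              (onFace-opposite f (onFace (Any.here ≡.refl))))

        positive : (τ : Vec Point (suc n)) → SimplexOnFace f τ → Small δ τ →
                   ∃ (_∈ₛ hitSet proj₁ τ)
        positive τ@(v ∷ _) onFace small =
          let (i , hits) = leb f (proj₁ v) (onFace (Any.here ≡.refl))
          in i , hitSet-complete proj₁ τ (λ {w} w∈ → hits (proj₁ w) (onFace w∈)
               (λ c → small w∈ (Any.here ≡.refl) c , small (Any.here ≡.refl) w∈ c))

        negative : (τ : Vec Point (suc n)) → SimplexOnFace f τ → Small δ τ →
                   ∃ (_∈ₛ hitSet minus τ)
        negative τ@(v ∷ _) onFace small =
          let (i , hits) = leb (opposite f) (minus v)
                  (onFace-opposite f (onFace (Any.here ≡.refl)))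
          in i , hitSet-complete minus τ
              (λ {w} w∈ → hits (minus w) (onFace-opposite f (onFace w∈))
               (λ c → ≤-respˡ-≈ (flip-sub (proj₁ v c) (proj₁ w c))
                   (small (Any.here ≡.refl) w∈ c) ,
                      ≤-respˡ-≈ (flip-sub (proj₁ w c) (proj₁ v c))
                          (small w∈ (Any.here ≡.refl) c)))
          where
          flip-sub : ∀ x y → x - y ≈ - y - - x
          flip-sub = solve 2 (λ x y → x :- y := :- y :- :- x) refl

        disjoint : (τ : Vec Point (suc n)) → ∀ {i} → i ∈ₛ hitSet proj₁ τ → i ∉ₛ hitSet minus τ
        disjoint τ@(v ∷ _) i∈ i∈′ = hits-antipode (hitSet-sound proj₁ τ i∈ (Any.here ≡.refl))
            (hitSet-sound minus τ i∈′ (Any.here ≡.refl))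

        -- Each of the n sign changes down the flag raises the rank by at least one, and the rank at
        -- the bottom is at most twice `⌈ d /2⌉`.
        alternating-rank : ∀ s (τ : Vec Point (suc n)) {κ} → SimplexOnFace f τ → Small δ τ →
                           Listing.Flag τ κ → alternating s (map simplexSign κ) ≡ true →
                           rank τ ℕ.+ n ℕ.≤ ⌈ d /2⌉ ℕ.+ ⌈ d /2⌉
        alternating-rank {n = zero} s τ onFace small flag alt =
          ℕ.≤-trans (ℕ.≤-reflexive (ℕ.+-identityʳ (rank τ))) (rank-few τ onFace)
        alternating-rank {n = suc n} s τ onFace small
            (Listing._∷_ {σ = σ} {ρ} σ⊂τ flag@(Listing._∷_ {ρ = ρ′} _ _)) alt =
          let (sτ , alt′) = alternating-uncons s (simplexSign (listing τ))
                  (map simplexSign ρ) alt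
              (sσ , _)    = alternating-uncons (not s) (simplexSign (listing σ))
                  (map simplexSign ρ′) alt′
              (i , i∈)    = positive τ onFace small
              rank< = leadingSign-strict (hitSet-antitone proj₁ {σ} {τ} (facet-⊆ σ⊂τ))
                  (hitSet-antitone minus {σ} {τ} (facet-⊆ σ⊂τ))
                        i∈ (disjoint τ i∈) (≡.trans sτ
                            (≡.trans (≡.sym (not-involutive s)) (≡.cong not (≡.sym sσ))))
          in ℕ.≤-trans (ℕ.≤-reflexive (ℕ.+-suc (rank τ) n))
               (ℕ.≤-trans (ℕ.+-monoˡ-≤ n rank<)
                 (alternating-rank (not s) σ (λ v∈ → onFace (facet-⊆ σ⊂τ v∈))
                     (λ v∈ w∈ → small (facet-⊆ σ⊂τ v∈) (facet-⊆ σ⊂τ w∈)) flag alt′))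

        no-alternation : (τ : Vec Point (suc d)) → SimplexOnFace f τ → Small δ τ →
                         ∀ κ → Listing.Flag τ κ → alternating true (map simplexSign κ) ≡ false
        -- An alternating flag would give 1 + 1 + d ≤ rank + d ≤ 2 * ⌈d/2⌉ ≤ d + 1.
        no-alternation τ onFace small κ flag = ¬-not λ alt → ℕ.<⇒≱ ℕ.≤-refl
          (ℕ.≤-trans (ℕ.≤-trans (ℕ.+-monoˡ-≤ d (ℕ.+-mono-≤
              (∈⇒1≤∣p∣ (proj₂ (positive τ onFace small)))
                  (∈⇒1≤∣p∣ (proj₂ (negative τ onFace small)))))
            (alternating-rank true τ onFace small flag alt)) (2*⌈n/2⌉≤1+n d))

        -- `halve` halves D before recursing, in step with `fans`, whose outermost subdivision
        -- halves the diameter and stays on the facet.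
        fans-vanish : ∀ r {D} → halve r D ≤ δ → (τ : Vec Point (suc d)) → SimplexOnFace f τ →
                      Small D τ → β⁺ (fans r) (suc d) τ ≡ false
        fans-vanish zero    D≤δ τ onFace small =
          Listing.sd-vanishes _ τ (no-alternation τ onFace
              (λ v∈ w∈ c → ≤-trans (small v∈ w∈ c) D≤δ))
        fans-vanish (suc r) D≤δ τ onFace small =
          Centres.sd-vanishes (β⁺ (fans r) (suc d)) τ
              (λ ρ flag → fans-vanish r D≤δ ρ (flag-onFace f onFace flag)
              (flag-small small flag))

      contradictory : ⊥
      contradictory =
        -- Points of one facet of the cube differ by at most 2 in each coordinate; r halvings bring
        -- this down to δ.
        let (r , small) = halve-small {1# + 1#} 0<δ
            F = subdivide dualVertex dualVertex-antipodal (fans r)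
        in true≢false (≡.trans (≡.sym (Polytope.fan F (axes (suc d))))
             (Polytope.evaluate-vanishes (axes (suc d)) (β⁺ F (suc d)) (λ τ t →
               Dual.sd-vanishes (β⁺ (fans r) (suc d)) τ (λ ρ flag →
                 let (f , _ , onFace) = dual-onFace (transversal-consistent t) flag
                 in fans-vanish f r small ρ onFace (onFace-small f onFace)))))
        where
        true≢false : ¬ (true ≡ false)
        true≢false ()

  one-fold : Guaranteed ℝ d 1 (suc ⌈ d /2⌉)
  one-fold m U (cover , antipodal) open-U = decidable-stable em λ none →
    let (δ , 0<δ , leb) = lebesgue U cover antipodal open-U
    in contradictory U cover antipodal open-U δ 0<δ leb
         (λ x I I⊆ → ℕ.≮⇒≥ (λ few → none (x , I , few , I⊆)))

  lower-bound : ∀ n → Guaranteed ℝ d (suc n) (suc n ℕ.+ ⌈ d /2⌉)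
  lower-bound zero    = one-fold
  lower-bound (suc n) = Induction.add-fold em ℝ d (suc n) (suc n ℕ.+ ⌈ d /2⌉) (ℕ.s≤s ℕ.z≤n)
      (lower-bound n)

-- Existence of the maximum

open import Data.Nat.Base using (_+_; _≤_)

-- Induction on the slack k between a known member l and the bound: either l is the maximum, or a
-- larger member uses up some of the slack.
maximum-exists : ExcludedMiddle (Level.suc 0ℓ) → (P : Pred ℕ (Level.suc 0ℓ)) → ∀ k l → P l →
                 (∀ q → P q → q ≤ l + k) → ∃ λ Q → IsMaximum P Q × l ≤ Q
maximum-exists em P zero    l Pl bound =
  l , (Pl , λ q Pq → ≡.subst (q ≤_) (ℕ.+-identityʳ l) (bound q Pq)) , ℕ.≤-refl
maximum-exists em P (suc k) l Pl bound with em {∃ λ q → P q × l ℕ.< q}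
... | no none = l , (Pl , λ q Pq → ℕ.≮⇒≥ λ l<q → none (q , Pq , l<q)) , ℕ.≤-refl
... | yes (l′ , Pl′ , l<l′) =
  let (Q , isMaximum , l′≤Q) = maximum-exists em P k l′ Pl′ λ q Pq →
        ℕ.≤-trans (bound q Pq) (ℕ.≤-trans (ℕ.≤-reflexive (ℕ.+-suc l k)) (ℕ.+-monoˡ-≤ k l<l′))
  in Q , isMaximum , ℕ.≤-trans (ℕ.<⇒≤ l<l′) l′≤Q

theorem2 : ExcludedMiddle (Level.suc 0ℓ) → (ℝ : Reals) → ∀ (d n : ℕ) → 1 ≤ d → 1 ≤ n →
    ∃ λ Q → IsMaximum (Guaranteed ℝ d n) Q × (⌈ d /2⌉ + n ≤ Q) × (Q ≤ d + n)
theorem2 em ℝ d (suc n) 1≤d 1≤n =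
  -- The slack d + n is generous, but it puts the bound d + n below l + k without any subtraction.
  let (Q , isMaximum , lower≤Q) = maximum-exists em (Guaranteed ℝ d (suc n)) (d + suc n)
        (⌈ d /2⌉ + suc n)
        (≡.subst (Guaranteed ℝ d (suc n)) (ℕ.+-comm (suc n) ⌈ d /2⌉)
            (LowerBound.lower-bound em₀ ℝ d n))
        (λ q guaranteed → ℕ.≤-trans (upper-bound q guaranteed)
            (ℕ.m≤n+m (d + suc n) (⌈ d /2⌉ + suc n)))
  in Q , isMaximum , lower≤Q , upper-bound Q (proj₁ isMaximum)
  where
  -- The search for the maximum uses excluded middle one level up, because `Guaranteed` quantifies
  -- over families of predicates; both bounds use it for small types.
  em₀ : ExcludedMiddle 0ℓ
  em₀ {P} = map′ Level.lower lift (em {Lift (Level.suc 0ℓ) P})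

  upper-bound : ∀ q → Guaranteed ℝ d (suc n) q → q ≤ d + suc n
  upper-bound = Gale.UpperBound.upper-bound em₀ ℝ d (suc n)
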